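{- Let $d\ge 1$ and let $Q=(q_1,\dots,q_{d+1})$ and $Q'=(q_1',\dots,q_{d+1}')$ be sequences of $d+1$ points in $\mathbb{R}^d$. Let $o\in\mathbb{R}^d$ and let $\Pi$ be an oriented hyperplane passing through $o$ such that: $Q\cup Q'\cup\{o\}$ is in general position; no point of $Q$ or $Q'$ lies on $\Pi$; and $o\in\operatorname{conv}(Q)$. Let $\pi_o$ be the signed central projection from $o$ with respect to $\Pi$ (and a hyperplane $\Pi'$ parallel to $\Pi$). Suppose that (i) $(\pi_o(q_1),\dots,\pi_o(q_{d+1}))\simeq(\pi_o(q_1'),\dots,\pi_o(q_{d+1}'))$ as sequences of points in $\mathbb{R}^{d-1}$; and (ii) $\operatorname{sgn}(\pi_o(q_i))=\operatorname{sgn}(\pi_o(q_i'))$ for every $1\le i\le d+1$. Then (1) $o\in\operatorname{conv}(Q')$; and (2) $Q\simeq Q'$.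
   Context: A set of points in $\mathbb{R}^d$ is in general position if no $j\le d+1$ of them lie in a common $(j-2)$-flat. The orientation of a $(d+1)$-tuple of points in $\mathbb{R}^d$ is $\chi(p_1,\dots,p_{d+1})=\operatorname{sgn}\det M$, where $M$ is the $(d+1)\times(d+1)$ matrix whose $i$-th row is $(1,p_i(1),\dots,p_i(d))$, with $p_i(j)$ the $j$-th coordinate of $p_i$. The same definition with $d-1$ in place of $d$ gives the orientation of $d$-tuples in $\mathbb{R}^{d-1}$. Two sequences $\sigma,\tau$ of $m$ points in $\mathbb{R}^e$ have the same labelled order type, $\sigma\simeq\tau$, if $\chi(\sigma(i_1),\dots,\sigma(i_{e+1}))=\chi(\tau(i_1),\dots,\tau(i_{e+1}))$ for all $1\le i_1<\cdots<i_{e+1}\le m$. Signed central projection: let $\Pi$ be an oriented hyperplane through $o\in\mathbb{R}^d$ with unit normal $\nu$ pointing to its positive side ("above" $\Pi$), and let $\Pi'=\Pi+h\nu$ with $h>0$ be a parallel hyperplane, identified with $\mathbb{R}^{d-1}$ via the origin $o+h\nu$ and an orthonormal basis $e_1,\dots,e_{d-1}$ of the direction space of $\Pi$ such that $(e_1,\dots,e_{d-1},\nu)$ is a positively oriented basis of $\mathbb{R}^d$. For $q\in\mathbb{R}^d\setminus\Pi$, let $\ell_q$ be the line through $o$ and $q$; then $\pi_o(q)\in\mathbb{R}^{d-1}$ is the point of $\ell_q\cap\Pi'$, and it carries a sign $\operatorname{sgn}(\pi_o(q)):=+1$ if $q$ is above $\Pi$ and $-1$ if $q$ is below $\Pi$.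 (For $o=0$, $\Pi=\{x_d=0\}$, $\Pi'=\{x_d=1\}$ this is $\pi_o(q)=(q(1)/q(d),\dots,q(d-1)/q(d))$ with sign $\operatorname{sgn}(q(d))$.) -}

module Defs where

open import Level using (Level; _⊔_) renaming (suc to lsuc)
open import Algebra.Bundles using (CommutativeRing)
open import Data.Fin.Base as Fin using (Fin; zero; suc; toℕ)
open import Data.Integer.Base using (ℤ; 0ℤ; 1ℤ; -1ℤ)
open import Data.Nat.Base as ℕ using (ℕ; zero; suc)
open import Data.Product using (∃; ∃-syntax; Σ-syntax; _×_)
open import Data.Vec.Functional using (Vector; _∷_; head; tail; removeAt)
open import Function.Base using (_∘_)
open import Relation.Binary.Core using (Rel)
open import Relation.Binary.Definitions using (tri<; tri≈; tri>)
open import Relation.Binary.Structures using (IsStrictTotalOrder)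
open import Relation.Binary.PropositionalEquality.Core using (_≡_; _≢_)
open import Relation.Nullary.Negation.Core using (¬_)
open import Relation.Unary using (Pred; _∈_)
import Relation.Binary.Construct.StrictToNonStrict as StrictToNonStrict

record OrderedField (c ℓ₁ ℓ₂ : Level) : Set (lsuc (c ⊔ ℓ₁ ⊔ ℓ₂)) where
  field
    commutativeRing : CommutativeRing c ℓ₁

  open CommutativeRing commutativeRing public

  infix 4 _<_
  field
    _<_                : Rel Carrier ℓ₂
    isStrictTotalOrder : IsStrictTotalOrder _≈_ _<_
    1≉0                : 1# ≉ 0#
    inv                : (x : Carrier) → x ≉ 0# → Carrier
    inverseʳ           : ∀ x (x≉0 : x ≉ 0#) → x * inv x x≉0 ≈ 1#
    +-monoˡ-<          : ∀ {x y} z → x < y → x + z < y + z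
    *-pos              : ∀ {x y} → 0# < x → 0# < y → 0# < x * y

  open IsStrictTotalOrder isStrictTotalOrder public
    using (compare; <-resp-≈)
    renaming (irrefl to <-irrefl; trans to <-trans)

  open StrictToNonStrict _≈_ _<_ public using (_≤_)

-- ℝ is given by its axioms, as a Dedekind-complete ordered field; classically
-- these determine it up to unique isomorphism.
record Reals (c ℓ₁ ℓ₂ : Level) : Set (lsuc (c ⊔ ℓ₁ ⊔ ℓ₂)) where
  field
    orderedField : OrderedField c ℓ₁ ℓ₂

  open OrderedField orderedField public

  IsUpperBound : Pred Carrier (c ⊔ ℓ₁ ⊔ ℓ₂) → Pred Carrier (c ⊔ ℓ₁ ⊔ ℓ₂)
  IsUpperBound P b = ∀ x → x ∈ P → x ≤ b

  field
    complete : (P : Pred Carrier (c ⊔ ℓ₁ ⊔ ℓ₂)) → ∃ P → ∃ (IsUpperBound P) →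
               ∃[ s ] (IsUpperBound P s × (∀ b → IsUpperBound P b → s ≤ b))

infixl 5 _∷ʳ_
_∷ʳ_ : ∀ {a} {A : Set a} {n} → Vector A n → A → Vector A (suc n)
_∷ʳ_ {n = zero}  xs y _       = y
_∷ʳ_ {n = suc n} xs y zero    = head xs
_∷ʳ_ {n = suc n} xs y (suc i) = (tail xs ∷ʳ y) i

module Geometry {c ℓ₁ ℓ₂} (F : OrderedField c ℓ₁ ℓ₂) where

  open OrderedField F
  open import Algebra.Properties.Semiring.Exp semiring using (_^_)
  open import Algebra.Properties.Semiring.Sum semiring using (sum)

  sgn : Carrier → ℤ
  sgn x with compare 0# x
  ... | tri< _ _ _ = 1ℤ
  ... | tri≈ _ _ _ = 0ℤ
  ... | tri> _ _ _ = -1ℤ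

  -- Laplace expansion along the first row.
  det : ∀ {n} → Vector (Vector Carrier n) n → Carrier
  det {zero}  M = 1#
  det {suc n} M = sum λ j →
    (- 1#) ^ toℕ j * (head M j * det λ i → removeAt (tail M i) j)

  Point : ℕ → Set c
  Point d = Vector Carrier d

  infix  4 _≋_
  infixl 6 _⊕_ _⊖_
  infixr 7 _⊙_

  _≋_ : ∀ {d} → Point d → Point d → Set ℓ₁
  p ≋ q = ∀ j → p j ≈ q j

  _⊕_ _⊖_ : ∀ {d} → Point d → Point d → Point d
  (p ⊕ q) j = p j + q j
  (p ⊖ q) j = p j - q j

  _⊙_ : ∀ {d} → Carrier → Point d → Point d
  (a ⊙ p) j = a * p j

  0ᵥ : ∀ {d} → Point d
  0ᵥ _ = 0#

  ⟨_,_⟩ : ∀ {d} → Point d → Point d → Carrier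
  ⟨ p , q ⟩ = sum λ j → p j * q j

  lincomb : ∀ {m d} → Vector Carrier m → Vector (Point d) m → Point d
  lincomb a v j = sum λ i → a i * v i j

  LinearlyIndependent : ∀ {m d} → Vector (Point d) m → Set (c ⊔ ℓ₁)
  LinearlyIndependent v = ∀ a → lincomb a v ≋ 0ᵥ → ∀ i → a i ≈ 0#

  record Flat (k d : ℕ) : Set (c ⊔ ℓ₁) where
    field
      base        : Point d
      directions  : Vector (Point d) k
      independent : LinearlyIndependent directions

  OnFlat : ∀ {k d} → Flat k d → Pred (Point d) (c ⊔ ℓ₁)
  OnFlat L x = ∃[ a ] x ≋ base ⊕ lincomb a directions
    where open Flat L

  -- Here k = j - 2.  For j ≤ 1 the condition is empty, since the (-1)-flat
  -- is the empty set.
  GeneralPosition : ∀ {d ℓ} → Pred (Point d) ℓ → Set (c ⊔ ℓ₁ ⊔ ℓ)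
  GeneralPosition {d} S =
    ∀ k → 2 ℕ.+ k ℕ.≤ suc d →
    (p : Vector (Point d) (2 ℕ.+ k)) →
    (∀ i j → i ≢ j → ¬ (p i ≋ p j)) →
    (∀ i → p i ∈ S) →
    ¬ (Σ[ L ∈ Flat k d ] (∀ i → p i ∈ OnFlat L))

  range : ∀ {d m} → Vector (Point d) m → Pred (Point d) ℓ₁
  range Q x = ∃[ i ] x ≋ Q i

  conv : ∀ {d m} → Vector (Point d) m → Pred (Point d) (c ⊔ ℓ₁ ⊔ ℓ₂)
  conv Q x = ∃[ a ] ((∀ i → 0# ≤ a i) × sum a ≈ 1# × x ≋ lincomb a Q)

  χ : ∀ {d} → Vector (Point d) (suc d) → ℤ
  χ p = sgn (det λ i → 1# ∷ p i)

  infix 4 _≃_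
  _≃_ : ∀ {e m} → Vector (Point e) m → Vector (Point e) m → Set
  _≃_ {e} {m} σ τ =
    (i : Fin (suc e) → Fin m) → (∀ {a b} → a Fin.< b → i a Fin.< i b) →
    χ (σ ∘ i) ≡ χ (τ ∘ i)

  record OrientedHyperplaneThrough {d} (o : Point d) : Set (c ⊔ ℓ₁) where
    field
      ν    : Point d
      unit : ⟨ ν , ν ⟩ ≈ 1#

    height : Point d → Carrier
    height q = ⟨ q ⊖ o , ν ⟩

    OnHyperplane : Pred (Point d) ℓ₁
    OnHyperplane q = height q ≈ 0#

  -- Π′ = Π + hν together with its identification with the space of
  -- dimension n = d - 1.
  record ParallelHyperplane {n} {o : Point (suc n)}
                            (Π : OrientedHyperplaneThrough o)
                            : Set (c ⊔ ℓ₁ ⊔ ℓ₂) where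
    open OrientedHyperplaneThrough Π
    field
      h          : Carrier
      h-positive : 0# < h
      e          : Vector (Point (suc n)) n
      e-unit     : ∀ i → ⟨ e i , e i ⟩ ≈ 1#
      e-orth     : ∀ i j → i ≢ j → ⟨ e i , e j ⟩ ≈ 0#
      e-parallel : ∀ i → ⟨ e i , ν ⟩ ≈ 0#
      -- When n = 0 the basis is empty and there is no choice to be made:
      -- demanding positivity there would exclude ν = -1.
      e-positive : 0 ℕ.< n → 0# < det (e ∷ʳ ν)

    -- The point o + t(q - o) with height h, i.e. t = h / height q.
    intersection : (q : Point (suc n)) → ¬ OnHyperplane q → Point (suc n)
    intersection q q∉Π = o ⊕ (h * inv (height q) q∉Π) ⊙ (q ⊖ o)

    π : (q : Point (suc n)) → ¬ OnHyperplane q → Point n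
    π q q∉Π i = ⟨ intersection q q∉Π ⊖ (o ⊕ h ⊙ ν) , e i ⟩

    -- Equal to 1 above Π and -1 below Π.
    sgnπ : (q : Point (suc n)) → ¬ OnHyperplane q → ℤ
    sgnπ q _ = sgn (height q)

{-# OPTIONS --safe #-}

-- Put uᵢ = qᵢ − o and let Dₖ be the determinant of the uᵢ with i ≠ k.  In the frame
-- (ν, e₁, …, eₙ) the row (1, π(qᵢ)) is a rescaling of uᵢ by 1 / height qᵢ, so (i) and (ii)
-- determine the sign of every Dₖ.  The cofactors (−1)ᵏ Dₖ are the coefficients of a linear
-- relation between the uₖ, and their sum S is det (1, qᵢ).  By Cramer's rule the k-th
-- barycentric coordinate of o with respect to Q is (−1)ᵏ Dₖ / S, hence o ∈ conv Q says that
-- all cofactors carry the sign of S.  The same then holds for Q′: its cofactors, divided by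
-- their sum, exhibit o ∈ conv Q′, and that sum has the same sign as S.  General position is
-- used once, to know that the cofactors of Q do not vanish.

module Submission where

open import Defs
open import Data.Fin.Base as Fin using (Fin; zero; suc; toℕ; punchIn; punchOut)
open import Data.Fin.Properties
  using (_≟_; any?; all?; punchIn-punchOut; punchIn-injective; punchIn-cancel-≤)
open import Data.Integer.Base as ℤ using (0ℤ; 1ℤ; -1ℤ)
import Data.Integer.Properties as ℤ
open import Data.Nat.Base as ℕ using (ℕ; zero; suc; z≤n; s≤s)
import Data.Nat.Properties as ℕ
open import Data.Product using (_,_; proj₁; proj₂; _×_; ∃-syntax)
open import Data.Sum.Base using (inj₁; inj₂)
open import Data.Vec.Functional
  using (Vector; _∷_; head; tail; removeAt; insertAt; transpose)
open import Function.Base using (_∘_)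
open import Level using (Level; _⊔_)
open import Relation.Binary.Definitions using (Decidable; tri<; tri≈; tri>)
open import Relation.Binary.PropositionalEquality.Core as ≡ using (_≡_; _≢_)
open import Relation.Nullary.Decidable using (yes; no; ¬?; decidable-stable; _×-dec_)
open import Relation.Nullary.Negation.Core using (¬_; contradiction)
open import Relation.Unary using (Pred; _∈_; _∪_)

-- `det` is given only by its Laplace expansion along the first row, which does not directly yield
-- alternation in the rows, invariance under transposition or multiplicativity. All three come from
-- one uniqueness statement for alternating forms, proved without any property of `det`. Expansion
-- along the first column is an iterated wedge product of linear forms, hence alternating.
-- Uniqueness identifies it with `det`, and multiplicativity follows by pulling `det` back along a
-- linear map.
--
-- A second obstacle is that general position constrains only distinct points, whereas the entries
-- of the sequence `Q` might coincide. That they do not is a consequence of `o` being an affine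
-- combination of `Q`: merging coincident entries would put `o` into the affine hull of too few
-- points.
--
-- The nonvanishing of the determinant `S′` belonging to `Q′` is obtained from signs alone: `S * S′`
-- is a sum of nonnegative terms, one of which is positive.

module LinearAlgebra {c ℓ₁ ℓ₂ : Level} (F : OrderedField c ℓ₁ ℓ₂) where

  open OrderedField F hiding (zero)
  open Geometry F
  open import Algebra.Properties.CommutativeSemigroup +-commutativeSemigroup
    using () renaming (interchange to +-interchange)
  open import Algebra.Properties.CommutativeSemigroup *-commutativeSemigroup
    using () renaming (x∙yz≈y∙xz to x*yz≈y*xz; interchange to *-interchange)
  open import Algebra.Properties.CommutativeMonoid.Sum *-commutativeMonoid
    using () renaming (sum to product)
  open import Algebra.Properties.Ring ring
  open import Algebra.Properties.Semiring.Exp semiring using (_^_)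
  open import Algebra.Properties.Semiring.Sum semiring
  open import Relation.Binary.Reasoning.Setoid setoid

  -- Pointwise equality of vectors and of families

  ≋-refl : ∀ {m} {x : Point m} → x ≋ x
  ≋-refl _ = refl

  ≋-sym : ∀ {m} {x y : Point m} → x ≋ y → y ≋ x
  ≋-sym x≋y j = sym (x≋y j)

  ≋-trans : ∀ {m} {x y z : Point m} → x ≋ y → y ≋ z → x ≋ z
  ≋-trans x≋y y≋z j = trans (x≋y j) (y≋z j)

  infix 4 _≋*_
  _≋*_ : ∀ {m k} → Vector (Point m) k → Vector (Point m) k → Set ℓ₁
  A ≋* B = ∀ i → A i ≋ B i

  ∷-cong : ∀ {m k} {x y : Point m} {A B : Vector (Point m) k} →
           x ≋ y → A ≋* B → x ∷ A ≋* y ∷ B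
  ∷-cong x≋y A≋B zero    = x≋y
  ∷-cong x≋y A≋B (suc i) = A≋B i

  η : ∀ {m k} (A : Vector (Point m) (suc k)) → A ≋* head A ∷ tail A
  η A zero    = ≋-refl
  η A (suc i) = ≋-refl

  -- Linear and alternating forms

  record IsLinear {m} (φ : Point m → Carrier) : Set (c ⊔ ℓ₁) where
    field
      cong        : ∀ {x y} → x ≋ y → φ x ≈ φ y
      additive    : ∀ x y → φ (x ⊕ y) ≈ φ x + φ y
      homogeneous : ∀ a x → φ (a ⊙ x) ≈ a * φ x

    preserves-0 : φ 0ᵥ ≈ 0#
    preserves-0 = begin
      φ 0ᵥ        ≈⟨ cong (λ _ → sym (zeroˡ 0#)) ⟩
      φ (0# ⊙ 0ᵥ) ≈⟨ homogeneous 0# 0ᵥ ⟩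
      0# * φ 0ᵥ   ≈⟨ zeroˡ _ ⟩
      0#          ∎

    preserves-lincomb : ∀ {k} (a : Vector Carrier k) (v : Vector (Point m) k) →
                        φ (lincomb a v) ≈ sum λ i → a i * φ (v i)
    preserves-lincomb {zero}  a v = preserves-0
    preserves-lincomb {suc k} a v = begin
      φ (a zero ⊙ v zero ⊕ lincomb (tail a) (tail v))
        ≈⟨ additive _ _ ⟩
      φ (a zero ⊙ v zero) + φ (lincomb (tail a) (tail v))
        ≈⟨ +-cong (homogeneous _ _) (preserves-lincomb (tail a) (tail v)) ⟩
      sum (λ i → a i * φ (v i)) ∎

  open IsLinear

  IsLinearMap : ∀ {m n} → (Point m → Point n) → Set (c ⊔ ℓ₁)
  IsLinearMap L = ∀ j → IsLinear λ x → L x j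

  proj-linear : ∀ {m} (j : Fin m) → IsLinear λ x → x j
  proj-linear j = record
    { cong = λ x≋y → x≋y j ; additive = λ _ _ → refl ; homogeneous = λ _ _ → refl }

  zero-linear : ∀ {m} → IsLinear {m} λ _ → 0#
  zero-linear = record
    { cong        = λ _ → refl
    ; additive    = λ _ _ → sym (+-identityˡ 0#)
    ; homogeneous = λ a _ → sym (zeroʳ a)
    }

  combination-linear : ∀ {m} {φ ψ : Point m → Carrier} a b →
                       IsLinear φ → IsLinear ψ → IsLinear λ x → a * φ x + b * ψ x
  combination-linear a b φ ψ = record
    { cong        = λ x≋y → +-cong (*-congˡ (cong φ x≋y)) (*-congˡ (cong ψ x≋y))
    ; additive    = λ x y → trans
        (+-cong (trans (*-congˡ (additive φ x y)) (distribˡ a _ _))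
                (trans (*-congˡ (additive ψ x y)) (distribˡ b _ _)))
        (+-interchange _ _ _ _)
    ; homogeneous = λ t x → trans
        (+-cong (trans (*-congˡ (homogeneous φ t x)) (x*yz≈y*xz a t _))
                (trans (*-congˡ (homogeneous ψ t x)) (x*yz≈y*xz b t _)))
        (sym (distribˡ t _ _))
    }

  resp-linear : ∀ {m} {φ ψ : Point m → Carrier} →
                (∀ x → φ x ≈ ψ x) → IsLinear φ → IsLinear ψ
  resp-linear φ≈ψ φ = record
    { cong        = λ x≋y → trans (sym (φ≈ψ _)) (trans (cong φ x≋y) (φ≈ψ _))
    ; additive    = λ x y → trans (sym (φ≈ψ _))
        (trans (additive φ x y) (+-cong (φ≈ψ x) (φ≈ψ y)))
    ; homogeneous = λ a x → trans (sym (φ≈ψ _))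
        (trans (homogeneous φ a x) (*-congˡ (φ≈ψ x)))
    }

  *-linear : ∀ {m} {φ : Point m → Carrier} b → IsLinear φ → IsLinear λ x → b * φ x
  *-linear b φ = resp-linear (λ x → trans (+-congˡ (zeroˡ _)) (+-identityʳ _))
    (combination-linear b 0# φ φ)

  linear-* : ∀ {m} {φ : Point m → Carrier} b → IsLinear φ → IsLinear λ x → φ x * b
  linear-* b φ = resp-linear (λ x → *-comm b _) (*-linear b φ)

  ∘-linear : ∀ {m n} {φ : Point n → Carrier} {L : Point m → Point n} →
             IsLinear φ → IsLinearMap L → IsLinear (φ ∘ L)
  ∘-linear φ L = record
    { cong        = λ x≋y → cong φ λ j → cong (L j) x≋y
    ; additive    = λ x y → trans (cong φ λ j → additive (L j) x y) (additive φ _ _)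
    ; homogeneous = λ a x → trans (cong φ λ j → homogeneous (L j) a x) (homogeneous φ a _)
    }

  Form : ℕ → ℕ → Set c
  Form m k = Vector (Point m) k → Carrier

  Congruent : ∀ {m k} → Form m k → Set (c ⊔ ℓ₁)
  Congruent f = ∀ {A B} → A ≋* B → f A ≈ f B

  record IsAlternatingSuc {m k} (P : Form m k → Set (c ⊔ ℓ₁)) (f : Form m (suc k)) :
                          Set (c ⊔ ℓ₁) where
    field
      congruent : Congruent f
      linear    : ∀ T → IsLinear λ x → f (x ∷ T)
      -- Writing i = 0 as a hypothesis keeps this meaningful when T is empty.
      adjacent  : ∀ x T i → toℕ i ≡ 0 → T i ≋ x → f (x ∷ T) ≈ 0#
      fix       : ∀ x → P λ T → f (x ∷ T)

  open IsAlternatingSuc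

  -- Unfolding `fix` gives linearity in every argument and vanishing on equal neighbours; vanishing
  -- on arbitrary equal pairs is derived in `repeated`. The base case asks for congruence because
  -- two empty families need not be definitionally equal.
  IsAlternating : ∀ {m k} → Form m k → Set (c ⊔ ℓ₁)
  IsAlternating {k = zero}  f = Congruent f
  IsAlternating {k = suc k} f = IsAlternatingSuc IsAlternating f

  alternating⇒congruent : ∀ {m k} {f : Form m k} → IsAlternating f → Congruent f
  alternating⇒congruent {k = zero}  f = f
  alternating⇒congruent {k = suc k} f = congruent f

  resp-alternating : ∀ {m k} {f g : Form m k} →
                     (∀ A → f A ≈ g A) → IsAlternating f → IsAlternating g
  resp-alternating {k = zero}  f≈g f A≋B = trans (sym (f≈g _)) (trans (f A≋B) (f≈g _))
  resp-alternating {k = suc k} f≈g f = record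
    { congruent = λ A≋B → trans (sym (f≈g _)) (trans (congruent f A≋B) (f≈g _))
    ; linear    = λ T → resp-linear (λ x → f≈g (x ∷ T)) (linear f T)
    ; adjacent  = λ x T i i≡0 Tᵢ≋x → trans (sym (f≈g _)) (adjacent f x T i i≡0 Tᵢ≋x)
    ; fix       = λ x → resp-alternating (λ T → f≈g (x ∷ T)) (fix f x)
    }

  combination-alternating : ∀ {m k} {f g : Form m k} a b → IsAlternating f →
                            IsAlternating g → IsAlternating λ A → a * f A + b * g A
  combination-alternating {k = zero} a b f g A≋B =
    +-cong (*-congˡ (f A≋B)) (*-congˡ (g A≋B))
  combination-alternating {k = suc k} a b f g = record
    { congruent = λ A≋B → +-cong (*-congˡ (congruent f A≋B)) (*-congˡ (congruent g A≋B))
    ; linear    = λ T → combination-linear a b (linear f T) (linear g T)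
    ; adjacent  = λ x T i i≡0 Tᵢ≋x → trans
        (+-cong (trans (*-congˡ (adjacent f x T i i≡0 Tᵢ≋x)) (zeroʳ a))
                (trans (*-congˡ (adjacent g x T i i≡0 Tᵢ≋x)) (zeroʳ b)))
        (+-identityˡ 0#)
    ; fix       = λ x → combination-alternating a b (fix f x) (fix g x)
    }

  map-∷ : ∀ {m n k} (L : Point m → Point n) x (T : Vector (Point m) k) →
          L ∘ (x ∷ T) ≋* L x ∷ L ∘ T
  map-∷ L x T zero    = ≋-refl
  map-∷ L x T (suc i) = ≋-refl

  pullback-alternating : ∀ {m n k} {f : Form n k} {L : Point m → Point n} →
                         IsLinearMap L → IsAlternating f → IsAlternating λ A → f (L ∘ A)
  pullback-alternating {k = zero}  L f A≋B = f λ i j → cong (L j) (A≋B i)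
  pullback-alternating {k = suc k} {L = ℒ} L f = record
    { congruent = λ A≋B → congruent f λ i j → cong (L j) (A≋B i)
    ; linear    = λ T → resp-linear (λ x → congruent f λ i → ≋-sym (map-∷ ℒ x T i))
        (∘-linear (linear f (ℒ ∘ T)) L)
    ; adjacent  = λ x T i i≡0 Tᵢ≋x → trans (congruent f (map-∷ ℒ x T))
        (adjacent f (ℒ x) (ℒ ∘ T) i i≡0 λ j → cong (L j) Tᵢ≋x)
    ; fix       = λ x → resp-alternating
        (λ T → congruent f λ i → ≋-sym (map-∷ ℒ x T i))
        (pullback-alternating L (fix f (ℒ x)))
    }

  module _ {m k} {f : Form m (suc (suc k))} (alt : IsAlternating f) where

    private
      linear₁ : ∀ x T → IsLinear λ y → f (x ∷ y ∷ T)
      linear₁ x = linear (fix alt x)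

      doubled : ∀ x T → f (x ∷ x ∷ T) ≈ 0#
      doubled x T = adjacent alt x (x ∷ T) zero ≡.refl ≋-refl

    -- Polarisation: in the expansion of `f ((x ⊕ y) ∷ (x ⊕ y) ∷ T)`, which vanishes, the two
    -- diagonal terms vanish as well.
    swap : ∀ x y T → f (x ∷ y ∷ T) ≈ - f (y ∷ x ∷ T)
    swap x y T = +-inverseˡ-unique _ _ (begin
      f (x ∷ y ∷ T) + f (y ∷ x ∷ T)
        ≈⟨ +-cong (+-identityˡ _) (+-identityʳ _) ⟨
      0# + f (x ∷ y ∷ T) + (f (y ∷ x ∷ T) + 0#)
        ≈⟨ +-cong (+-congʳ (doubled x T)) (+-congˡ (doubled y T)) ⟨
      f (x ∷ x ∷ T) + f (x ∷ y ∷ T) + (f (y ∷ x ∷ T) + f (y ∷ y ∷ T))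
        ≈⟨ +-cong (additive (linear₁ x T) x y) (additive (linear₁ y T) x y) ⟨
      f (x ∷ (x ⊕ y) ∷ T) + f (y ∷ (x ⊕ y) ∷ T)
        ≈⟨ additive (linear alt ((x ⊕ y) ∷ T)) x y ⟨
      f ((x ⊕ y) ∷ (x ⊕ y) ∷ T)
        ≈⟨ doubled (x ⊕ y) T ⟩
      0# ∎)

  -- Moving `x` past `head T` turns the coincidence into one for the form with `head T` fixed, which
  -- has one argument fewer.
  repeated : ∀ {m k} {f : Form m (suc k)} → IsAlternating f →
             ∀ x T i → T i ≋ x → f (x ∷ T) ≈ 0#
  repeated f x T zero Tᵢ≋x = adjacent f x T zero ≡.refl Tᵢ≋x
  repeated {k = suc k} {f} alt x T (suc i) Tᵢ≋x = begin
    f (x ∷ T)                 ≈⟨ congruent alt (∷-cong ≋-refl (η T)) ⟩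
    f (x ∷ head T ∷ tail T)   ≈⟨ swap alt x (head T) (tail T) ⟩
    - f (head T ∷ x ∷ tail T) ≈⟨ -‿cong (repeated (fix alt (head T)) x (tail T) i Tᵢ≋x) ⟩
    - 0#                      ≈⟨ -0#≈0# ⟩
    0#                        ∎

  -- Generalises `shear` from `f (r ∷ _)` to any alternating form that vanishes as soon as an
  -- argument equals `r`. This property survives fixing the first argument, as the induction
  -- requires.
  shear-vanishing : ∀ {m k} {g : Form m k} → IsAlternating g →
                    ∀ r → (∀ B i → B i ≋ r → g B ≈ 0#) →
                    ∀ (s : Vector Carrier k) B → g (λ i → B i ⊕ s i ⊙ r) ≈ g B
  shear-vanishing {k = zero}  g r g-vanish s B = g λ ()
  shear-vanishing {k = suc k} {g} alt r g-vanish s B = begin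
    g B′                                   ≈⟨ congruent alt (η B′) ⟩
    g ((head B ⊕ head s ⊙ r) ∷ tail B′)    ≈⟨ additive (linear alt _) _ _ ⟩
    g (head B ∷ tail B′) + g (head s ⊙ r ∷ tail B′)
      ≈⟨ +-congˡ (homogeneous (linear alt _) _ _) ⟩
    g (head B ∷ tail B′) + head s * g (r ∷ tail B′)
      ≈⟨ +-congˡ (*-congˡ (g-vanish (r ∷ tail B′) zero ≋-refl)) ⟩
    g (head B ∷ tail B′) + head s * 0#     ≈⟨ +-congˡ (zeroʳ _) ⟩
    g (head B ∷ tail B′) + 0#              ≈⟨ +-identityʳ _ ⟩
    g (head B ∷ tail B′)
      ≈⟨ shear-vanishing (fix alt (head B)) r
           (λ T i Tᵢ≋r → g-vanish (head B ∷ T) (suc i) Tᵢ≋r) (tail s) (tail B) ⟩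
    g (head B ∷ tail B)                    ≈⟨ congruent alt (η B) ⟨
    g B                                    ∎
    where
    B′ : Vector (Point _) (suc k)
    B′ i = B i ⊕ s i ⊙ r

  shear : ∀ {m k} {f : Form m (suc k)} → IsAlternating f →
          ∀ r (s : Vector Carrier k) B → f (r ∷ λ i → B i ⊕ s i ⊙ r) ≈ f (r ∷ B)
  shear f r = shear-vanishing (fix f r) r (repeated f r)

  row-to-front : ∀ {m k} {f : Form m (suc k)} → IsAlternating f →
                  ∀ A j → f (A j ∷ removeAt A j) ≈ (- 1#) ^ toℕ j * f A
  row-to-front alt A zero =
    trans (congruent alt λ i → ≋-sym (η A i)) (sym (*-identityˡ _))
  row-to-front {k = suc k} {f} alt A (suc j) = begin
    f (A (suc j) ∷ removeAt A (suc j))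
      ≈⟨ congruent alt (∷-cong ≋-refl (η (removeAt A (suc j)))) ⟩
    f (A (suc j) ∷ head A ∷ removeAt (tail A) j)
      ≈⟨ swap alt _ _ _ ⟩
    - f (head A ∷ A (suc j) ∷ removeAt (tail A) j)
      ≈⟨ -‿cong (row-to-front (fix alt (head A)) (tail A) j) ⟩
    - ((- 1#) ^ toℕ j * f (head A ∷ tail A))
      ≈⟨ -‿cong (*-congˡ (congruent alt (η A))) ⟨
    - ((- 1#) ^ toℕ j * f A)
      ≈⟨ -1*x≈-x _ ⟨
    - 1# * ((- 1#) ^ toℕ j * f A)
      ≈⟨ *-assoc _ _ _ ⟨
    (- 1#) ^ toℕ (suc j) * f A ∎

  scale-rows : ∀ {m k} {f : Form m k} → IsAlternating f →
               ∀ s A → f (λ i → s i ⊙ A i) ≈ product s * f A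
  scale-rows {k = zero}  f s A = trans (f λ ()) (sym (*-identityˡ _))
  scale-rows {k = suc k} {f} alt s A = begin
    f (λ i → s i ⊙ A i)                      ≈⟨ congruent alt (η _) ⟩
    f (head s ⊙ head A ∷ λ i → s (suc i) ⊙ A (suc i))
      ≈⟨ homogeneous (linear alt _) _ _ ⟩
    head s * f (head A ∷ λ i → s (suc i) ⊙ A (suc i))
      ≈⟨ *-congˡ (scale-rows (fix alt (head A)) (tail s) (tail A)) ⟩
    head s * (product (tail s) * f (head A ∷ tail A))
      ≈⟨ *-assoc _ _ _ ⟨
    product s * f (head A ∷ tail A)
      ≈⟨ *-congˡ (congruent alt (η A)) ⟨
    product s * f A ∎

  -- Defined by recursion rather than as the sum in wedge-expand, so that fixing the
  -- first argument leaves a combination of D and a smaller wedge product.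
  wedge : ∀ {m k} → (Point m → Carrier) → Form m k → Form m (suc k)
  wedge {k = zero}  φ D A = φ (head A) * D (tail A)
  wedge {k = suc k} φ D A =
    φ (head A) * D (tail A) + (- 1#) * wedge φ (λ T → D (head A ∷ T)) (tail A)

  wedge-expand : ∀ {m k} φ {D : Form m k} → Congruent D → ∀ A →
                 wedge φ D A ≈ sum λ j → (- 1#) ^ toℕ j * (φ (A j) * D (removeAt A j))
  wedge-expand {k = zero} φ D-cong A = sym (trans (+-identityʳ _) (*-identityˡ _))
  wedge-expand {k = suc k} φ {D} D-cong A = +-cong (sym (*-identityˡ _)) (begin
    (- 1#) * wedge φ (λ T → D (head A ∷ T)) (tail A)
      ≈⟨ *-congˡ (wedge-expand φ (λ T≋T′ → D-cong (∷-cong ≋-refl T≋T′)) (tail A)) ⟩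
    (- 1#) * (sum λ j → (- 1#) ^ toℕ j *
                        (φ (A (suc j)) * D (head A ∷ removeAt (tail A) j)))
      ≈⟨ *-distribˡ-sum (- 1#) (λ j → (- 1#) ^ toℕ j *
           (φ (A (suc j)) * D (head A ∷ removeAt (tail A) j))) ⟩
    sum (λ j → (- 1#) * ((- 1#) ^ toℕ j *
               (φ (A (suc j)) * D (head A ∷ removeAt (tail A) j))))
      ≈⟨ sum-cong-≋ {suc k} (λ j → trans (sym (*-assoc (- 1#) ((- 1#) ^ toℕ j) (φ (A (suc j)) * _)))
           (*-congˡ (*-congˡ (D-cong λ i → ≋-sym (η (removeAt A (suc j)) i))))) ⟩
    sum (λ j → (- 1#) ^ toℕ (suc j) * (φ (A (suc j)) * D (removeAt A (suc j)))) ∎)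

  wedge-cong : ∀ {m k} {φ : Point m → Carrier} {D E : Form m k} → IsLinear φ →
               (∀ {S T} → S ≋* T → D S ≈ E T) → ∀ {A B} → A ≋* B →
               wedge φ D A ≈ wedge φ E B
  wedge-cong {k = zero}  φ D≈E A≋B = *-cong (cong φ (A≋B zero)) (D≈E (A≋B ∘ suc))
  wedge-cong {k = suc k} φ D≈E A≋B =
    +-cong (*-cong (cong φ (A≋B zero)) (D≈E (A≋B ∘ suc)))
      (*-congˡ (wedge-cong φ (λ S≋T → D≈E (∷-cong (A≋B zero) S≋T)) (A≋B ∘ suc)))

  wedge-zero : ∀ {m k} {φ : Point m → Carrier} {D : Form m k} →
               (∀ T → D T ≈ 0#) → ∀ A → wedge φ D A ≈ 0#
  wedge-zero {k = zero}  D≈0 A = trans (*-congˡ (D≈0 _)) (zeroʳ _)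
  wedge-zero {k = suc k} D≈0 A = trans
    (+-cong (trans (*-congˡ (D≈0 _)) (zeroʳ _))
            (trans (*-congˡ (wedge-zero (λ T → D≈0 _) (tail A))) (zeroʳ _)))
    (+-identityˡ 0#)

  -- The first argument of a wedge product reaches the remaining, smaller wedge product only through
  -- the form being wedged. Hence linearity in the form, and not in a vector argument, is what
  -- `wedge-alternating` calls for.
  wedge-linear : ∀ {n m k} (φ : Point m → Carrier) {E : Point n → Form m k} →
                 (∀ T → IsLinear λ r → E r T) → ∀ A → IsLinear λ r → wedge φ (E r) A
  wedge-linear {k = zero}  φ E A = *-linear _ (E _)
  wedge-linear {k = suc k} φ E A =
    combination-linear _ _ (E _) (wedge-linear φ (λ T → E _) (tail A))

  wedge-alternating : ∀ {m k} {φ : Point m → Carrier} {D : Form m k} →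
                      IsLinear φ → IsAlternating D → IsAlternating (wedge φ D)
  wedge-alternating {k = zero} φ D = record
    { congruent = wedge-cong φ D
    ; linear    = λ T → linear-* _ φ
    ; adjacent  = λ _ _ ()
    ; fix       = λ x A≋B → wedge-cong φ D (∷-cong ≋-refl A≋B)
    }
  wedge-alternating {k = suc k} {φ} {D} φ-lin alt = record
    { congruent = wedge-cong φ-lin (congruent alt)
    ; linear    = λ T → resp-linear (λ _ → +-congʳ (*-comm _ _))
        (combination-linear _ _ φ-lin (wedge-linear φ (linear alt) T))
    ; adjacent  = wedge-adjacent alt
    ; fix       = λ r → combination-alternating (φ r) (- 1#) alt
        (wedge-alternating φ-lin (fix alt r))
    }
    where
    cancel : ∀ {k} {D : Form _ (suc k)} → IsAlternating D → ∀ r T → T zero ≋ r →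
             φ r * D T + (- 1#) * (φ (head T) * D (r ∷ tail T)) ≈ 0#
    cancel {D = D} alt r T T₀≋r = begin
      φ r * D T + (- 1#) * (φ (head T) * D (r ∷ tail T))
        ≈⟨ +-cong (*-cong (cong φ-lin (≋-sym T₀≋r))
             (congruent alt λ { zero → T₀≋r ; (suc i) → ≋-refl })) (-1*x≈-x _) ⟩
      φ (head T) * D (r ∷ tail T) - φ (head T) * D (r ∷ tail T)
        ≈⟨ -‿inverseʳ _ ⟩
      0# ∎

    -- When the first two arguments agree, the two terms in which `φ` consumes one of them cancel,
    -- and every other term passes both to `D`.
    wedge-adjacent : ∀ {k} {D : Form _ (suc k)} → IsAlternating D →
                     ∀ r T i → toℕ i ≡ 0 → T i ≋ r →
                     φ r * D T + (- 1#) * wedge φ (λ S → D (r ∷ S)) T ≈ 0#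
    wedge-adjacent {zero} alt r T zero ≡.refl T₀≋r = cancel alt r T T₀≋r
    wedge-adjacent {suc k} {D} alt r T zero ≡.refl T₀≋r = begin
      φ r * D T + (- 1#) * (φ (head T) * D (r ∷ tail T) + (- 1#) * W)
        ≈⟨ +-congˡ (*-congˡ (+-congˡ (trans (*-congˡ W≈0) (zeroʳ _)))) ⟩
      φ r * D T + (- 1#) * (φ (head T) * D (r ∷ tail T) + 0#)
        ≈⟨ +-congˡ (*-congˡ (+-identityʳ _)) ⟩
      φ r * D T + (- 1#) * (φ (head T) * D (r ∷ tail T))
        ≈⟨ cancel alt r T T₀≋r ⟩
      0# ∎
      where
      W : Carrier
      W = wedge φ (λ S → D (r ∷ head T ∷ S)) (tail T)
      W≈0 : W ≈ 0#
      W≈0 = wedge-zero (λ S → adjacent alt r (head T ∷ S) zero ≡.refl T₀≋r) (tail T)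

  -- Determinants

  sum-zero : ∀ {n} {t : Vector Carrier n} → (∀ i → t i ≈ 0#) → sum t ≈ 0#
  sum-zero {n} t≈0 = trans (sum-cong-≋ t≈0) (sum-replicate-zero n)

  sum-single : ∀ {n} k {t : Vector Carrier (suc n)} →
               (∀ i → t (punchIn k i) ≈ 0#) → sum t ≈ t k
  sum-single k {t} t≈0 =
     trans (sum-remove {i = k} t) (trans (+-congˡ (sum-zero t≈0)) (+-identityʳ _))

  basis : ∀ {m} → Vector (Point m) m
  basis zero    = 1# ∷ 0ᵥ
  basis (suc i) = 0# ∷ basis i

  basis-sym : ∀ {m} (i j : Fin m) → basis i j ≡ basis j i
  basis-sym zero    zero    = ≡.refl
  basis-sym zero    (suc j) = ≡.refl
  basis-sym (suc i) zero    = ≡.refl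
  basis-sym (suc i) (suc j) = basis-sym i j

  lincomb-basis : ∀ {m} (x : Point m) → lincomb x basis ≋ x
  lincomb-basis x zero = trans
    (+-cong (*-identityʳ _) (sum-zero λ i → zeroʳ (x (suc i)))) (+-identityʳ _)
  lincomb-basis x (suc j) = trans
    (+-cong (zeroʳ _) (lincomb-basis (tail x) j)) (+-identityˡ _)

  lincomb-basisˡ : ∀ {m k} i (v : Vector (Point m) k) → lincomb (basis i) v ≋ v i
  lincomb-basisˡ i v j = trans
    (sum-cong-≋ λ l → trans (*-comm _ _) (*-congˡ (reflexive (basis-sym i l))))
    (lincomb-basis (λ l → v l j) i)

  insertAt-linear : ∀ {m} (j : Fin (suc m)) →
                    IsLinearMap {m} λ x → insertAt x j 0#
  insertAt-linear         zero    zero    = zero-linear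
  insertAt-linear         zero    (suc l) = proj-linear l
  insertAt-linear {suc m} (suc j) zero    = proj-linear zero
  insertAt-linear {suc m} (suc j) (suc l) =
    ∘-linear (insertAt-linear j l) (proj-linear ∘ suc)

  insertAt-0ᵥ : ∀ {m} (j : Fin (suc m)) → insertAt 0ᵥ j 0# ≋ 0ᵥ
  insertAt-0ᵥ j l = preserves-0 (insertAt-linear j l)

  insertAt-basis : ∀ {m} (j : Fin (suc m)) i →
                   insertAt (basis i) j 0# ≋ basis (punchIn j i)
  insertAt-basis zero    i       zero    = refl
  insertAt-basis zero    i       (suc l) = refl
  insertAt-basis (suc j) zero    zero    = refl
  insertAt-basis (suc j) zero    (suc l) = insertAt-0ᵥ j l
  insertAt-basis (suc j) (suc i) zero    = refl
  insertAt-basis (suc j) (suc i) (suc l) = insertAt-basis j i l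

  removeAt-insertAt : ∀ {m} (j : Fin (suc m)) (x : Point (suc m)) →
                      x ≋ insertAt (removeAt x j) j 0# ⊕ x j ⊙ basis j
  removeAt-insertAt zero    x zero    = sym (trans (+-identityˡ _) (*-identityʳ _))
  removeAt-insertAt zero    x (suc l) = sym (trans (+-congˡ (zeroʳ _)) (+-identityʳ _))
  removeAt-insertAt {suc m} (suc j) x zero = sym (trans (+-congˡ (zeroʳ _)) (+-identityʳ _))
  removeAt-insertAt {suc m} (suc j) x (suc l) = removeAt-insertAt j (tail x) l

  -- An alternating form on n vectors of length n is a multiple of the
  -- determinant.  Nothing about det itself is needed for this: the shear removes
  -- the j-th coordinate of the other rows once the first one is basis j.
  alternating-unique : ∀ {n} {f : Form n n} → IsAlternating f →
                       ∀ A → f A ≈ f basis * det A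
  alternating-unique {zero}      f A = trans (f λ ()) (sym (*-identityʳ _))
  alternating-unique {suc n} {f} alt A = begin
    f A                                   ≈⟨ congruent alt (η A) ⟩
    f (head A ∷ T)
      ≈⟨ congruent alt (∷-cong (≋-sym (lincomb-basis (head A))) λ _ → ≋-refl) ⟩
    f (lincomb (head A) basis ∷ T)
      ≈⟨ preserves-lincomb (linear alt T) (head A) basis ⟩
    sum (λ j → head A j * f (basis j ∷ T))
      ≈⟨ sum-cong-≋ {suc n} (λ j → trans (*-congˡ {head A j} (term j))
           (trans (*-congˡ (trans (*-congʳ (*-comm _ _)) (*-assoc _ _ _)))
                  (trans (x*yz≈y*xz _ _ _) (*-congˡ (x*yz≈y*xz _ _ _))))) ⟩
    sum (λ j → f basis * ((- 1#) ^ toℕ j * (head A j * det (minor j))))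
      ≈⟨ *-distribˡ-sum (f basis)
           (λ j → (- 1#) ^ toℕ j * (head A j * det (minor j))) ⟨
    f basis * det A ∎
    where
    T = tail A
    minor : Fin (suc n) → Vector (Point n) n
    minor j i = removeAt (T i) j
    term : ∀ j → f (basis j ∷ T) ≈ (- 1#) ^ toℕ j * f basis * det (minor j)
    term j = begin
      f (basis j ∷ T)
        ≈⟨ congruent alt (∷-cong ≋-refl λ i → removeAt-insertAt j (T i)) ⟩
      f (basis j ∷ λ i → insertAt (minor j i) j 0# ⊕ T i j ⊙ basis j)
        ≈⟨ shear alt (basis j) (λ i → T i j) (λ i → insertAt (minor j i) j 0#) ⟩
      f (basis j ∷ λ i → insertAt (minor j i) j 0#)
        -- The induction hypothesis concerns the form that fixes `basis j` and inserts a zero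
        -- coordinate into the other arguments. Its leading constant is `f` at a reordered standard
        -- basis, which is where the Laplace sign arises.
        ≈⟨ alternating-unique (pullback-alternating (insertAt-linear j)
             (fix alt (basis j))) (minor j) ⟩
      f (basis j ∷ λ i → insertAt (basis i) j 0#) * det (minor j)
        ≈⟨ *-congʳ (congruent alt (∷-cong ≋-refl (insertAt-basis j))) ⟩
      f (basis j ∷ removeAt basis j) * det (minor j)
        ≈⟨ *-congʳ (row-to-front alt basis j) ⟩
      (- 1#) ^ toℕ j * f basis * det (minor j) ∎

  det-basis : ∀ {n} → det (basis {n}) ≈ 1#
  det-basis {zero}  = refl
  det-basis {suc n} =
    trans (sum-single zero {term} λ j → trans (*-congˡ {(- 1#) ^ toℕ (suc j)}
            (zeroˡ (det λ i → removeAt (0# ∷ basis i) (suc j)))) (zeroʳ _))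
          (trans (*-identityˡ _) (trans (*-identityˡ _) (det-basis {n})))
    where
    term : Vector Carrier (suc n)
    term j = (- 1#) ^ toℕ j * (basis {suc n} zero j * det λ i → removeAt (0# ∷ basis i) j)

  -- The transposed Laplace expansion is an iterated wedge product.
  det∘transpose-alternating : ∀ {n} → IsAlternating {n} {n} (det ∘ transpose)
  det∘transpose-alternating {zero}  _ = refl
  det∘transpose-alternating {suc n} = resp-alternating
    (wedge-expand (λ x → x zero) (alternating⇒congruent D))
    (wedge-alternating (proj-linear zero) D)
    where
    D : IsAlternating λ (B : Vector (Point (suc n)) n) → det (transpose (tail ∘ B))
    D = pullback-alternating (proj-linear ∘ suc) det∘transpose-alternating

  -- Uniqueness makes `det ∘ transpose` a multiple of `det`, and the factor is 1 because the
  -- identity matrix is symmetric. Only through this equality does `det` itself become known as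
  -- alternating.
  det-transpose : ∀ {n} (A : Vector (Point n) n) → det (transpose A) ≈ det A
  det-transpose {n} A = begin
    det (transpose A)      ≈⟨ alternating-unique det∘transpose-alternating A ⟩
    det (transpose I) * det A
      ≈⟨ *-congʳ (alternating⇒congruent (det∘transpose-alternating {n}) {I} {transpose I}
           λ i j → reflexive (basis-sym i j)) ⟩
    det I * det A          ≈⟨ *-congʳ (det-basis {n}) ⟩
    1# * det A             ≈⟨ *-identityˡ _ ⟩
    det A                  ∎
    where
    I : Vector (Point n) n
    I = basis

  det-alternating : ∀ {n} → IsAlternating {n} {n} det
  det-alternating {n} = resp-alternating det-transpose (det∘transpose-alternating {n})

  det-cong : ∀ {n} → Congruent {n} {n} det
  det-cong = alternating⇒congruent det-alternating

  -- Multiplicativity, obtained as uniqueness for the pullback of `det` along `L`; the factor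
  -- `det (L ∘ basis)` is the determinant of the map.
  det-map : ∀ {n} {L : Point n → Point n} → IsLinearMap L → ∀ A →
            det (L ∘ A) ≈ det (L ∘ basis) * det A
  det-map L = alternating-unique (pullback-alternating L det-alternating)

  det-expand-column : ∀ {n} (x : Vector Carrier (suc n)) (A : Vector (Point n) (suc n)) →
    det (λ k → x k ∷ A k) ≈ sum λ k → (- 1#) ^ toℕ k * (x k * det (removeAt A k))
  det-expand-column {n} x A = trans (sym (det-transpose λ k → x k ∷ A k))
    (sum-cong-≋ {suc n} λ k → *-congˡ {(- 1#) ^ toℕ k}
      (*-congˡ {x k} (det-transpose (removeAt A k))))

  transpose-∷ : ∀ {m n} (x : Vector Carrier m) (A : Vector (Point n) m) →
                transpose (λ i → x i ∷ A i) ≋* x ∷ transpose A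
  transpose-∷ x A zero    = ≋-refl
  transpose-∷ x A (suc j) = ≋-refl

  det-repeated-column : ∀ {n} (A : Vector (Point n) (suc n)) j → det (λ k → A k j ∷ A k) ≈ 0#
  det-repeated-column {n} A j = begin
    det (λ k → A k j ∷ A k)             ≈⟨ det-transpose (λ k → A k j ∷ A k) ⟨
    det (transpose λ k → A k j ∷ A k)   ≈⟨ det-cong (transpose-∷ (transpose A j) A) ⟩
    det (transpose A j ∷ transpose A)   ≈⟨ repeated det-alternating _ (transpose A) j ≋-refl ⟩
    0#                                  ∎

  det-column-to-front : ∀ {n} (A : Vector (Point (suc n)) (suc n)) j →
    det (λ i → A i j ∷ removeAt (A i) j) ≈ (- 1#) ^ toℕ j * det A
  det-column-to-front {n} A j = begin
    det (λ i → A i j ∷ removeAt (A i) j)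
      ≈⟨ det-transpose (λ i → A i j ∷ removeAt (A i) j) ⟨
    det (transpose λ i → A i j ∷ removeAt (A i) j)
      ≈⟨ det-cong (transpose-∷ (transpose A j) λ i → removeAt (A i) j) ⟩
    det (transpose A j ∷ removeAt (transpose A) j)
      ≈⟨ row-to-front det-alternating (transpose A) j ⟩
    (- 1#) ^ toℕ j * det (transpose A)
      ≈⟨ *-congˡ (det-transpose A) ⟩
    (- 1#) ^ toℕ j * det A ∎

  -- Translating the rows by o is a shear of the columns along the column of ones.
  det-translate : ∀ {n} (o : Point n) (A : Vector (Point n) (suc n)) →
                  det (λ i → 1# ∷ A i ⊖ o) ≈ det (λ i → 1# ∷ A i)
  det-translate {n} o A = begin
    det (λ i → 1# ∷ A i ⊖ o)
      ≈⟨ det-transpose (λ i → 1# ∷ A i ⊖ o) ⟨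
    det (transpose λ i → 1# ∷ A i ⊖ o)
      ≈⟨ det-cong columns ⟩
    det ((λ _ → 1#) ∷ λ j → transpose A j ⊕ (- o j) ⊙ λ _ → 1#)
      ≈⟨ shear det-alternating (λ _ → 1#) (λ j → - o j) (transpose A) ⟩
    det ((λ _ → 1#) ∷ transpose A)
      ≈⟨ det-cong (transpose-∷ (λ _ → 1#) A) ⟨
    det (transpose λ i → 1# ∷ A i)
      ≈⟨ det-transpose (λ i → 1# ∷ A i) ⟩
    det (λ i → 1# ∷ A i) ∎
    where
    columns : transpose (λ i → 1# ∷ A i ⊖ o) ≋*
              (λ _ → 1#) ∷ λ j → transpose A j ⊕ (- o j) ⊙ λ _ → 1#
    columns zero    i = refl
    columns (suc j) i = +-congˡ (sym (*-identityʳ _))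

  -- Signs

  infix 4 _≈?_
  _≈?_ : Decidable _≈_
  x ≈? y with compare x y
  ... | tri< _ x≉y _ = no x≉y
  ... | tri≈ _ x≈y _ = yes x≈y
  ... | tri> _ x≉y _ = no x≉y

  x*y≈0⇒y≈0 : ∀ {x y} → x ≉ 0# → x * y ≈ 0# → y ≈ 0#
  x*y≈0⇒y≈0 {x} {y} x≉0 xy≈0 = begin
    y                  ≈⟨ *-identityˡ y ⟨
    1# * y             ≈⟨ *-congʳ (trans (*-comm _ _) (inverseʳ x x≉0)) ⟨
    inv x x≉0 * x * y  ≈⟨ *-assoc _ _ _ ⟩
    inv x x≉0 * (x * y) ≈⟨ *-congˡ xy≈0 ⟩
    inv x x≉0 * 0#     ≈⟨ zeroʳ _ ⟩
    0#                 ∎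

  x*y≉0 : ∀ {x y} → x ≉ 0# → y ≉ 0# → x * y ≉ 0#
  x*y≉0 x≉0 y≉0 xy≈0 = y≉0 (x*y≈0⇒y≈0 x≉0 xy≈0)

  inv≉0 : ∀ {x} (x≉0 : x ≉ 0#) → inv x x≉0 ≉ 0#
  inv≉0 x≉0 x⁻¹≈0 = 1≉0 (trans (sym (inverseʳ _ x≉0)) (trans (*-congˡ x⁻¹≈0) (zeroʳ _)))

  product≉0 : ∀ {n} {s : Vector Carrier n} → (∀ i → s i ≉ 0#) → product s ≉ 0#
  product≉0 {zero}  s≉0 = 1≉0
  product≉0 {suc n} s≉0 = x*y≉0 (s≉0 zero) (product≉0 (s≉0 ∘ suc))

  <-respʳ : ∀ {x y z} → y ≈ z → x < y → x < z
  <-respʳ = proj₁ <-resp-≈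

  <-respˡ : ∀ {x y z} → y ≈ z → y < x → z < x
  <-respˡ = proj₂ <-resp-≈

  x<0⇒0<-x : ∀ {x} → x < 0# → 0# < - x
  x<0⇒0<-x {x} x<0 = <-respˡ (-‿inverseʳ x) (<-respʳ (+-identityˡ _) (+-monoˡ-< (- x) x<0))

  0<x⇒-x<0 : ∀ {x} → 0# < x → - x < 0#
  0<x⇒-x<0 {x} 0<x = <-respʳ (-‿inverseʳ x) (<-respˡ (+-identityˡ _) (+-monoˡ-< (- x) 0<x))

  neg*neg : ∀ {x y} → x < 0# → y < 0# → 0# < x * y
  neg*neg {x} {y} x<0 y<0 = <-respʳ -x*-y≈x*y (*-pos (x<0⇒0<-x x<0) (x<0⇒0<-x y<0))
    where
    -x*-y≈x*y : - x * - y ≈ x * y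
    -x*-y≈x*y = begin
      - x * - y     ≈⟨ -‿distribˡ-* x (- y) ⟨
      - (x * - y)   ≈⟨ -‿cong (sym (-‿distribʳ-* x y)) ⟩
      - - (x * y)   ≈⟨ -‿involutive _ ⟩
      x * y         ∎

  neg*pos : ∀ {x y} → x < 0# → 0# < y → x * y < 0#
  neg*pos {x} {y} x<0 0<y = <-respˡ -[-x*y]≈x*y (0<x⇒-x<0 (*-pos (x<0⇒0<-x x<0) 0<y))
    where
    -[-x*y]≈x*y : - (- x * y) ≈ x * y
    -[-x*y]≈x*y = trans (-‿cong (sym (-‿distribˡ-* x y))) (-‿involutive _)

  x≉0⇒0<x*x : ∀ {x} → x ≉ 0# → 0# < x * x
  x≉0⇒0<x*x {x} x≉0 with compare 0# x
  ... | tri< 0<x _ _ = *-pos 0<x 0<x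
  ... | tri≈ _ 0≈x _ = contradiction (sym 0≈x) x≉0
  ... | tri> _ _ x<0 = neg*neg x<0 x<0

  0<1 : 0# < 1#
  0<1 = <-respʳ (*-identityˡ 1#) (x≉0⇒0<x*x 1≉0)

  sgn-pos : ∀ {x} → 0# < x → sgn x ≡ 1ℤ
  sgn-pos {x} 0<x with compare 0# x
  ... | tri< _ _ _   = ≡.refl
  ... | tri≈ 0≮x _ _ = contradiction 0<x 0≮x
  ... | tri> 0≮x _ _ = contradiction 0<x 0≮x

  sgn-zero : ∀ {x} → 0# ≈ x → sgn x ≡ 0ℤ
  sgn-zero {x} 0≈x with compare 0# x
  ... | tri< _ 0≉x _ = contradiction 0≈x 0≉x
  ... | tri≈ _ _ _   = ≡.refl
  ... | tri> _ 0≉x _ = contradiction 0≈x 0≉x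

  sgn-neg : ∀ {x} → x < 0# → sgn x ≡ -1ℤ
  sgn-neg {x} x<0 with compare 0# x
  ... | tri< _ _ x≮0 = contradiction x<0 x≮0
  ... | tri≈ _ _ x≮0 = contradiction x<0 x≮0
  ... | tri> _ _ _   = ≡.refl

  sgn≡1⇒pos : ∀ {x} → sgn x ≡ 1ℤ → 0# < x
  sgn≡1⇒pos {x} eq with compare 0# x
  sgn≡1⇒pos {x} _  | tri< 0<x _ _ = 0<x
  sgn≡1⇒pos {x} () | tri≈ _ _ _
  sgn≡1⇒pos {x} () | tri> _ _ _

  sgn≡0⇒zero : ∀ {x} → sgn x ≡ 0ℤ → 0# ≈ x
  sgn≡0⇒zero {x} eq with compare 0# x
  sgn≡0⇒zero {x} () | tri< _ _ _
  sgn≡0⇒zero {x} _  | tri≈ _ 0≈x _ = 0≈x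
  sgn≡0⇒zero {x} () | tri> _ _ _

  sgn-cong : ∀ {x y} → x ≈ y → sgn x ≡ sgn y
  sgn-cong {x} {y} x≈y with compare 0# x
  ... | tri< 0<x _ _ = ≡.sym (sgn-pos (<-respʳ x≈y 0<x))
  ... | tri≈ _ 0≈x _ = ≡.sym (sgn-zero (trans 0≈x x≈y))
  ... | tri> _ _ x<0 = ≡.sym (sgn-neg (<-respˡ x≈y x<0))

  sgn-* : ∀ x y → sgn (x * y) ≡ sgn x ℤ.* sgn y
  sgn-* x y with compare 0# x | compare 0# y
  ... | tri< 0<x _ _ | tri< 0<y _ _ = sgn-pos (*-pos 0<x 0<y)
  ... | tri< 0<x _ _ | tri≈ _ 0≈y _ = sgn-zero (trans (sym (zeroʳ x)) (*-congˡ 0≈y))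
  ... | tri< 0<x _ _ | tri> _ _ y<0 = sgn-neg (<-respˡ (*-comm y x) (neg*pos y<0 0<x))
  ... | tri≈ _ 0≈x _ | tri< _ _ _   = sgn-zero (trans (sym (zeroˡ y)) (*-congʳ 0≈x))
  ... | tri≈ _ 0≈x _ | tri≈ _ _ _   = sgn-zero (trans (sym (zeroˡ y)) (*-congʳ 0≈x))
  ... | tri≈ _ 0≈x _ | tri> _ _ _   = sgn-zero (trans (sym (zeroˡ y)) (*-congʳ 0≈x))
  ... | tri> _ _ x<0 | tri< 0<y _ _ = sgn-neg (neg*pos x<0 0<y)
  ... | tri> _ _ x<0 | tri≈ _ 0≈y _ = sgn-zero (trans (sym (zeroʳ x)) (*-congˡ 0≈y))
  ... | tri> _ _ x<0 | tri> _ _ y<0 = sgn-pos (neg*neg x<0 y<0)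

  sgn-*-cong : ∀ {x y z w} → sgn x ≡ sgn y → sgn z ≡ sgn w → sgn (x * z) ≡ sgn (y * w)
  sgn-*-cong {x} {y} {z} {w} x~y z~w =
    ≡.trans (sgn-* x z) (≡.trans (≡.cong₂ ℤ._*_ x~y z~w) (≡.sym (sgn-* y w)))

  sgn-*-cancelˡ : ∀ {x y z w} → x ≉ 0# → sgn x ≡ sgn y →
                  sgn (x * z) ≡ sgn (y * w) → sgn z ≡ sgn w
  sgn-*-cancelˡ {x} {y} {z} {w} x≉0 x~y xz~yw =
    ℤ.*-cancelˡ-≡ (sgn x) (sgn z) (sgn w)
      {{ℤ.≢-nonZero λ x~0 → x≉0 (sym (sgn≡0⇒zero x~0))}}
      (≡.trans (≡.sym (sgn-* x z)) (≡.trans xz~yw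
        (≡.trans (sgn-* y w) (≡.cong (ℤ._* sgn w) (≡.sym x~y)))))

  -- Both `x * inv x x≉0` and `x * x` are positive, so the common factor `x` cancels.
  sgn-inv : ∀ {x} (x≉0 : x ≉ 0#) → sgn (inv x x≉0) ≡ sgn x
  sgn-inv {x} x≉0 = sgn-*-cancelˡ x≉0 ≡.refl
    (≡.trans (sgn-cong (inverseʳ x x≉0))
      (≡.trans (sgn-pos 0<1) (≡.sym (sgn-pos (x≉0⇒0<x*x x≉0)))))

  sgn-product : ∀ {n} {s t : Vector Carrier n} → (∀ i → sgn (s i) ≡ sgn (t i)) →
                sgn (product s) ≡ sgn (product t)
  sgn-product {zero}  s~t = ≡.refl
  sgn-product {suc n} s~t = sgn-*-cong (s~t zero) (sgn-product (s~t ∘ suc))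

  0≤-resp-sgn : ∀ {x y} → sgn x ≡ sgn y → 0# ≤ x → 0# ≤ y
  0≤-resp-sgn x~y (inj₁ 0<x) = inj₁ (sgn≡1⇒pos (≡.trans (≡.sym x~y) (sgn-pos 0<x)))
  0≤-resp-sgn x~y (inj₂ 0≈x) = inj₂ (sgn≡0⇒zero (≡.trans (≡.sym x~y) (sgn-zero 0≈x)))

  0≤x∧x≉0⇒0<x : ∀ {x} → 0# ≤ x → x ≉ 0# → 0# < x
  0≤x∧x≉0⇒0<x (inj₁ 0<x) x≉0 = 0<x
  0≤x∧x≉0⇒0<x (inj₂ 0≈x) x≉0 = contradiction (sym 0≈x) x≉0

  *-nonNeg-pos : ∀ {x y} → 0# ≤ x → 0# < y → 0# ≤ x * y
  *-nonNeg-pos (inj₁ 0<x) 0<y = inj₁ (*-pos 0<x 0<y)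
  *-nonNeg-pos (inj₂ 0≈x) 0<y = inj₂ (trans (sym (zeroˡ _)) (*-congʳ 0≈x))

  +-pos-nonNeg : ∀ {x y} → 0# < x → 0# ≤ y → 0# < x + y
  +-pos-nonNeg {x} {y} 0<x (inj₁ 0<y) =
    <-trans 0<y (<-respˡ (+-identityˡ y) (+-monoˡ-< y 0<x))
  +-pos-nonNeg 0<x (inj₂ 0≈y) = <-respʳ (trans (sym (+-identityʳ _)) (+-congˡ 0≈y)) 0<x

  sum-nonNeg : ∀ {n} {t : Vector Carrier n} → (∀ i → 0# ≤ t i) → 0# ≤ sum t
  sum-nonNeg {zero}      0≤t = inj₂ refl
  sum-nonNeg {suc n} {t} 0≤t with 0≤t zero
  ... | inj₁ 0<t₀ = inj₁ (+-pos-nonNeg 0<t₀ (sum-nonNeg (0≤t ∘ suc)))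
  ... | inj₂ 0≈t₀ with sum-nonNeg (0≤t ∘ suc)
  ...   | inj₁ 0<Σ = inj₁ (<-respʳ (trans (sym (+-identityˡ _)) (+-congʳ 0≈t₀)) 0<Σ)
  ...   | inj₂ 0≈Σ = inj₂ (trans (sym (+-identityˡ _)) (+-cong 0≈t₀ 0≈Σ))

  -- Nonsingularity and Cramer's rule

  -- Gaussian elimination: B is the Schur complement of the pivot p in the first row.
  independent⇒det≉0 : ∀ {n} (A : Vector (Point n) n) → LinearlyIndependent A → det A ≉ 0#
  independent⇒det≉0 {zero}  A indep = 1≉0
  independent⇒det≉0 {suc n} A indep with any? (λ j → ¬? (A zero j ≈? 0#))
  ... | no ∄pivot = contradiction (indep (basis zero) A₀≋0 zero) 1≉0
    where
    A₀≋0 : lincomb (basis zero) A ≋ 0ᵥ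
    A₀≋0 j = trans (lincomb-basisˡ zero A j)
      (decidable-stable (A zero j ≈? 0#) λ A₀ⱼ≉0 → ∄pivot (j , A₀ⱼ≉0))
  ... | yes (j , p≉0) = λ detA≈0 → independent⇒det≉0 B B-independent
    (x*y≈0⇒y≈0 p≉0 (begin
      p * det B                                  ≈⟨ *-identityˡ _ ⟨
      1# * (p * det B)                           ≈⟨ sum-single zero {term} term≈0 ⟨
      sum term
        ≈⟨ det-expand-column (λ k → C k j) (λ k → removeAt (C k) j) ⟨
      det (λ k → C k j ∷ removeAt (C k) j)       ≈⟨ det-column-to-front C j ⟩
      (- 1#) ^ toℕ j * det C
        ≈⟨ *-congˡ (trans (shear (det-alternating {suc n}) (A zero) s (tail A))
             (det-cong {suc n} {A zero ∷ tail A} {A} λ i → ≋-sym (η A i))) ⟩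
      (- 1#) ^ toℕ j * det A                     ≈⟨ *-congˡ detA≈0 ⟩
      (- 1#) ^ toℕ j * 0#                        ≈⟨ zeroʳ _ ⟩
      0#                                         ∎))
    where
    p = A zero j
    s : Vector Carrier n
    s i = - (A (suc i) j * inv p p≉0)
    R : Vector (Point (suc n)) n
    R i = A (suc i) ⊕ s i ⊙ A zero
    B : Vector (Point n) n
    B i = removeAt (R i) j
    C : Vector (Point (suc n)) (suc n)
    C = A zero ∷ R
    term : Vector Carrier (suc n)
    term k = (- 1#) ^ toℕ k * (C k j * det (removeAt (λ l → removeAt (C l) j) k))
    R≈0 : ∀ i → R i j ≈ 0#
    R≈0 i = begin
      A (suc i) j + - (A (suc i) j * inv p p≉0) * p
        ≈⟨ +-congˡ (-‿distribˡ-* _ p) ⟨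
      A (suc i) j - A (suc i) j * inv p p≉0 * p
        ≈⟨ +-congˡ (-‿cong (trans (*-assoc _ _ _)
             (trans (*-congˡ (trans (*-comm _ p) (inverseʳ p p≉0))) (*-identityʳ _)))) ⟩
      A (suc i) j - A (suc i) j
        ≈⟨ -‿inverseʳ _ ⟩
      0# ∎
    term≈0 : ∀ i → term (suc i) ≈ 0#
    term≈0 i = trans (*-congˡ {(- 1#) ^ toℕ (suc i)} (trans (*-congʳ (R≈0 i)) (zeroˡ _))) (zeroʳ _)
    module _ (b : Vector Carrier n) (bB≋0 : lincomb b B ≋ 0ᵥ) where
      -- `B` omits only column `j`, in which every row of `R` is zero, so a relation between the
      -- rows of `B` lifts to `R`.
      bR≋0 : lincomb b R ≋ 0ᵥ
      bR≋0 l with j ≟ l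
      ... | yes ≡.refl = sum-zero λ i → trans (*-congˡ (R≈0 i)) (zeroʳ (b i))
      ... | no j≢l     =
        ≡.subst (λ k → lincomb b R k ≈ 0#) (punchIn-punchOut j≢l) (bB≋0 (punchOut j≢l))
      relation : lincomb ((sum λ i → b i * s i) ∷ b) A ≋ 0ᵥ
      relation l = begin
        (sum λ i → b i * s i) * A zero l + (sum λ i → b i * A (suc i) l)
          ≈⟨ +-congʳ (*-distribʳ-sum (A zero l) (λ i → b i * s i)) ⟩
        (sum λ i → b i * s i * A zero l) + (sum λ i → b i * A (suc i) l)
          ≈⟨ +-comm _ _ ⟩
        (sum λ i → b i * A (suc i) l) + (sum λ i → b i * s i * A zero l)
          ≈⟨ ∑-distrib-+ (λ i → b i * A (suc i) l) (λ i → b i * s i * A zero l) ⟨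
        (sum λ i → b i * A (suc i) l + b i * s i * A zero l)
          ≈⟨ sum-cong-≋ (λ i → trans (distribˡ (b i) _ _) (+-congˡ (sym (*-assoc (b i) _ _)))) ⟨
        lincomb b R l
          ≈⟨ bR≋0 l ⟩
        0# ∎
    B-independent : LinearlyIndependent B
    B-independent b bB≋0 i =
      indep ((sum λ i → b i * s i) ∷ b) (relation b bB≋0) (suc i)

  cofactor : ∀ {n} → Vector (Point n) (suc n) → Vector Carrier (suc n)
  cofactor u k = (- 1#) ^ toℕ k * det (removeAt u k)

  -- Coordinate `j` of the relation is the expansion, along its first column, of a matrix in which
  -- that column repeats column `j` of `u`.
  cofactor-relation : ∀ {n} (u : Vector (Point n) (suc n)) → lincomb (cofactor u) u ≋ 0ᵥ
  cofactor-relation {n} u j = begin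
    sum (λ k → cofactor u k * u k j)
      ≈⟨ sum-cong-≋ {suc n} (λ k → trans (*-assoc ((- 1#) ^ toℕ k) _ _)
           (*-congˡ {(- 1#) ^ toℕ k} (*-comm (det (removeAt u k)) (u k j)))) ⟩
    sum (λ k → (- 1#) ^ toℕ k * (u k j * det (removeAt u k)))
      ≈⟨ det-expand-column (λ k → u k j) u ⟨
    det (λ k → u k j ∷ u k)
      ≈⟨ det-repeated-column u j ⟩
    0# ∎

  sum-cofactor : ∀ {n} (u : Vector (Point n) (suc n)) → sum (cofactor u) ≈ det (λ k → 1# ∷ u k)
  sum-cofactor {n} u = sym (trans (det-expand-column (λ _ → 1#) u)
    (sum-cong-≋ {suc n} λ k → *-congˡ {(- 1#) ^ toℕ k} (*-identityˡ (det (removeAt u k)))))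

  sign²≈1 : ∀ n → (- 1#) ^ n * (- 1#) ^ n ≈ 1#
  sign²≈1 zero    = *-identityˡ 1#
  sign²≈1 (suc n) = trans (*-interchange _ _ _ _) (trans (*-cong
    (trans (-1*x≈-x _) (-‿involutive 1#)) (sign²≈1 n)) (*-identityˡ 1#))

  -- Cramer's rule for the system Σ aᵢ (1 ∷ uᵢ) = 1 ∷ 0.
  cramer : ∀ {n} (u : Vector (Point n) (suc n)) a → sum a ≈ 1# → lincomb a u ≋ 0ᵥ →
           ∀ k → cofactor u k ≈ a k * det (λ i → 1# ∷ u i)
  cramer {n} u a Σa≈1 au≋0 k = begin
    ς * det (removeAt u k)       ≈⟨ *-congˡ g-e₀ ⟨
    ς * g (1# ∷ 0ᵥ)              ≈⟨ *-congˡ (g-cong aW≋e₀) ⟨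
    ς * g (lincomb a W)          ≈⟨ *-congˡ (preserves-lincomb g-linear a W) ⟩
    ς * (sum λ i → a i * g (W i)) ≈⟨ *-congˡ {ς} (sum-single k {λ i → a i * g (W i)} λ i → trans
                                     (*-congˡ {a (punchIn k i)} (repeated (det-alternating {suc n})
                                       _ (removeAt W k) i ≋-refl)) (zeroʳ _)) ⟩
    ς * (a k * g (W k))          ≈⟨ *-congˡ (*-congˡ (row-to-front (det-alternating {suc n}) W k)) ⟩
    ς * (a k * (ς * det W))      ≈⟨ x*yz≈y*xz _ _ _ ⟩
    a k * (ς * (ς * det W))      ≈⟨ *-congˡ (*-assoc _ _ _) ⟨
    a k * (ς * ς * det W)        ≈⟨ *-congˡ (trans (*-congʳ (sign²≈1 (toℕ k))) (*-identityˡ _)) ⟩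
    a k * det W                  ∎
    where
    ς = (- 1#) ^ toℕ k
    W : Vector (Point (suc n)) (suc n)
    W i = 1# ∷ u i
    -- Row `k` is moved to the front and replaced by a variable vector. Evaluating at `1# ∷ 0ᵥ`
    -- gives the minor, while expanding the same vector as `lincomb a W` leaves only the term of
    -- index `k`, since any other row is repeated.
    g : Point (suc n) → Carrier
    g y = det (y ∷ removeAt W k)
    g-linear : IsLinear g
    g-linear = linear (det-alternating {suc n}) (removeAt W k)
    g-cong : ∀ {x y} → x ≋ y → g x ≈ g y
    g-cong = cong g-linear
    aW≋e₀ : lincomb a W ≋ 1# ∷ 0ᵥ
    aW≋e₀ zero    = trans (sum-cong-≋ {suc n} λ i → *-identityʳ (a i)) Σa≈1
    aW≋e₀ (suc j) = au≋0 j
    term : Vector Carrier (suc n)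
    term j = (- 1#) ^ toℕ j * ((1# ∷ 0ᵥ) j * det λ i → removeAt (removeAt W k i) j)
    g-e₀ : g (1# ∷ 0ᵥ) ≈ det (removeAt u k)
    g-e₀ = trans (sum-single zero {term} λ j → trans
        (*-congˡ {(- 1#) ^ toℕ (suc j)}
          (zeroˡ (det λ i → removeAt (removeAt W k i) (suc j)))) (zeroʳ _))
      (trans (*-identityˡ _) (*-identityˡ _))

  lincomb-⊖ : ∀ {m k} a (v : Vector (Point m) k) o → sum a ≈ 1# →
              lincomb a (λ i → v i ⊖ o) ≋ lincomb a v ⊖ o
  lincomb-⊖ a v o Σa≈1 j = begin
    sum (λ i → a i * (v i j - o j))
      ≈⟨ sum-cong-≋ (λ i → distribˡ (a i) _ _) ⟩
    sum (λ i → a i * v i j + a i * - o j)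
      ≈⟨ ∑-distrib-+ (λ i → a i * v i j) (λ i → a i * - o j) ⟩
    sum (λ i → a i * v i j) + sum (λ i → a i * - o j)
      ≈⟨ +-congˡ (*-distribʳ-sum (- o j) a) ⟨
    sum (λ i → a i * v i j) + sum a * - o j
      ≈⟨ +-congˡ (trans (*-congʳ Σa≈1) (*-identityˡ _)) ⟩
    lincomb a v j - o j ∎

  -- General position

  sum-basis : ∀ {m} (i : Fin m) → sum (basis i) ≈ 1#
  sum-basis i = trans (sum-cong-≋ λ l → sym (*-identityʳ (basis i l)))
    (lincomb-basisˡ {1} i (λ _ _ → 1#) zero)

  -- The weight of `v i` is transferred to its twin `v j`, whose index after the deletion is
  -- `punchOut i≢j`. Keeping the total weight lets affine relations survive the merging.
  merge : ∀ {m k} (v : Vector (Point m) (suc k)) {i j} → i ≢ j → v i ≋ v j → ∀ a →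
          ∃[ b ] (sum b ≈ sum a × lincomb b (removeAt v i) ≋ lincomb a v)
  merge {k = k} v {i} {j} i≢j vᵢ≋vⱼ a = b , sum-b , lincomb-b
    where
    l = punchOut i≢j
    b : Vector Carrier k
    b = removeAt a i ⊕ a i ⊙ basis l
    sum-b : sum b ≈ sum a
    sum-b = begin
      sum b
        ≈⟨ ∑-distrib-+ (removeAt a i) (a i ⊙ basis l) ⟩
      sum (removeAt a i) + sum (a i ⊙ basis l)
        ≈⟨ +-congˡ (*-distribˡ-sum (a i) (basis l)) ⟨
      sum (removeAt a i) + a i * sum (basis l)
        ≈⟨ +-congˡ (trans (*-congˡ (sum-basis l)) (*-identityʳ _)) ⟩
      sum (removeAt a i) + a i
        ≈⟨ +-comm _ _ ⟩
      a i + sum (removeAt a i)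
        ≈⟨ sum-remove a ⟨
      sum a ∎
    w = removeAt v i
    lincomb-b : lincomb b w ≋ lincomb a v
    lincomb-b t = begin
      sum (λ r → (a (punchIn i r) + a i * basis l r) * w r t)
        ≈⟨ sum-cong-≋ (λ r → trans (distribʳ (w r t) _ _) (+-congˡ (*-assoc _ _ _))) ⟩
      sum (λ r → a (punchIn i r) * w r t + a i * (basis l r * w r t))
        ≈⟨ ∑-distrib-+ (λ r → a (punchIn i r) * w r t) (λ r → a i * (basis l r * w r t)) ⟩
      sum (λ r → a (punchIn i r) * w r t) + sum (λ r → a i * (basis l r * w r t))
        ≈⟨ +-congˡ (*-distribˡ-sum (a i) (λ r → basis l r * w r t)) ⟨
      sum (λ r → a (punchIn i r) * w r t) + a i * lincomb (basis l) w t
        ≈⟨ +-congˡ (*-congˡ (trans (lincomb-basisˡ l w t) (trans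
             (reflexive (≡.cong (λ r → v r t) (punchIn-punchOut i≢j))) (sym (vᵢ≋vⱼ t))))) ⟩
      sum (λ r → a (punchIn i r) * w r t) + a i * v i t
        ≈⟨ +-comm _ _ ⟩
      a i * v i t + sum (λ r → a (punchIn i r) * w r t)
        ≈⟨ sum-remove {i = i} (λ r → a r * v r t) ⟨
      lincomb a v t ∎

  x≋o⊕[x⊖o] : ∀ {m} (x o : Point m) → x ≋ o ⊕ (x ⊖ o)
  x≋o⊕[x⊖o] x o j = sym (trans (+-comm _ _) (trans (+-assoc _ _ _)
    (trans (+-congˡ (-‿inverseˡ _)) (+-identityʳ _))))

  module _ {d ℓ} {S : Pred (Point d) ℓ} (gp : GeneralPosition S) {o} (o∈S : o ∈ S) where

    -- By induction the tail directions are independent and span an `m`-flat through `o`. A nonzero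
    -- leading coefficient would place `v zero` on it too, giving `m + 2` distinct points of `S` on
    -- an `m`-flat. The empty family needs no clause, as it has no index to treat.
    independent : ∀ m → m ℕ.≤ d → (v : Vector (Point d) m) →
                  (∀ i → v i ∈ S) → (∀ i → ¬ v i ≋ o) → (∀ i j → i ≢ j → ¬ v i ≋ v j) →
                  LinearlyIndependent (λ i → v i ⊖ o)
    independent (suc m) m<d v v∈S v≉o v-distinct a av≋0 = a≈0
      where
      tail-independent : LinearlyIndependent (λ i → v (suc i) ⊖ o)
      tail-independent = independent m (ℕ.<⇒≤ m<d) (tail v) (v∈S ∘ suc) (v≉o ∘ suc)
        λ i j i≢j → v-distinct (suc i) (suc j) λ { ≡.refl → i≢j ≡.refl }

      L : Flat m d
      L = record { base = o ; directions = λ i → v (suc i) ⊖ o ; independent = tail-independent }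
      open Flat L using (directions)

      p-distinct : ∀ i j → i ≢ j → ¬ (o ∷ v) i ≋ (o ∷ v) j
      p-distinct zero    zero    0≢0 = contradiction ≡.refl 0≢0
      p-distinct zero    (suc j) _   = λ o≋v → v≉o j (≋-sym o≋v)
      p-distinct (suc i) zero    _   = v≉o i
      p-distinct (suc i) (suc j) i≢j = v-distinct i j λ { ≡.refl → i≢j ≡.refl }

      module _ (a₀≉0 : a zero ≉ 0#) where
        a₀⁻¹ = inv (a zero) a₀≉0
        b : Vector Carrier m
        b i = - a₀⁻¹ * a (suc i)

        v₀⊖o : v zero ⊖ o ≋ lincomb b directions
        v₀⊖o j = begin
          v zero j - o j
            ≈⟨ trans (*-congʳ (trans (*-comm _ _) (inverseʳ _ a₀≉0))) (*-identityˡ _) ⟨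
          a₀⁻¹ * a zero * (v zero j - o j)
            ≈⟨ *-assoc _ _ _ ⟩
          a₀⁻¹ * (a zero * (v zero j - o j))
            ≈⟨ *-congˡ (+-inverseˡ-unique _ _ (av≋0 j)) ⟩
          a₀⁻¹ * - lincomb (tail a) directions j
            ≈⟨ trans (sym (-‿distribʳ-* _ _)) (-‿distribˡ-* _ _) ⟩
          - a₀⁻¹ * lincomb (tail a) directions j
            ≈⟨ *-distribˡ-sum (- a₀⁻¹) (λ i → a (suc i) * directions i j) ⟩
          sum (λ i → - a₀⁻¹ * (a (suc i) * directions i j))
            ≈⟨ sum-cong-≋ (λ i → *-assoc (- a₀⁻¹) (a (suc i)) (directions i j)) ⟨
          lincomb b directions j ∎

        onFlat : ∀ i → (o ∷ v) i ∈ OnFlat L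
        onFlat zero = (λ _ → 0#) , λ j → sym (trans
          (+-congˡ (sum-zero λ i → zeroˡ (directions i j))) (+-identityʳ _))
        onFlat (suc zero) = b , ≋-trans (x≋o⊕[x⊖o] (v zero) o) λ j → +-congˡ (v₀⊖o j)
        onFlat (suc (suc i)) = basis i , ≋-trans (x≋o⊕[x⊖o] (v (suc i)) o)
          λ j → +-congˡ (sym (lincomb-basisˡ i directions j))

      a₀≈0 : a zero ≈ 0#
      a₀≈0 = decidable-stable (a zero ≈? 0#) λ a₀≉0 →
        gp m (s≤s m<d) (o ∷ v) p-distinct (λ { zero → o∈S ; (suc i) → v∈S i })
           (L , onFlat a₀≉0)

      a≈0 : ∀ i → a i ≈ 0#
      a≈0 zero    = a₀≈0
      a≈0 (suc i) = tail-independent (tail a)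
        (λ j → trans (sym (trans (+-congʳ (trans (*-congʳ a₀≈0) (zeroˡ _))) (+-identityˡ _)))
                     (av≋0 j)) i

    -- Coincident points are merged, since general position only speaks about
    -- distinct ones.
    ∉-affine-hull : ∀ m → m ℕ.≤ d → (v : Vector (Point d) m) →
                    (∀ i → v i ∈ S) → (∀ i → ¬ v i ≋ o) →
                    ∀ a → sum a ≈ 1# → ¬ lincomb a (λ i → v i ⊖ o) ≋ 0ᵥ
    ∉-affine-hull m m≤d v v∈S v≉o a Σa≈1 av≋0
      with any? (λ i → any? λ j → ¬? (i ≟ j) ×-dec all? λ l → v i l ≈? v j l)
    ... | no v-distinct = 1≉0 (trans (sym Σa≈1) (sum-zero
            (independent m m≤d v v∈S v≉o
              (λ i j i≢j vᵢ≋vⱼ → v-distinct (i , j , i≢j , vᵢ≋vⱼ)) a av≋0)))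
    ∉-affine-hull (suc m) m<d v v∈S v≉o a Σa≈1 av≋0
      | yes (i , j , i≢j , vᵢ≋vⱼ) =
      let b , Σb≈Σa , bv≋av = merge (λ i → v i ⊖ o) i≢j (λ l → +-congʳ (vᵢ≋vⱼ l)) a in
      ∉-affine-hull m (ℕ.<⇒≤ m<d) (removeAt v i) (v∈S ∘ punchIn i) (v≉o ∘ punchIn i)
        b (trans Σb≈Σa Σa≈1) (≋-trans bv≋av av≋0)

    -- Independence is available only for distinct points, so coincidences have to be excluded:
    -- merging two equal entries would leave `d` points of `S` with `o` in their affine hull. After
    -- that, any `d` entries of `Q` have independent differences from `o`.
    cofactor≉0 : (Q : Vector (Point d) (suc d)) → (∀ i → Q i ∈ S) → (∀ i → ¬ Q i ≋ o) →
                 ∀ a → sum a ≈ 1# → lincomb a (λ i → Q i ⊖ o) ≋ 0ᵥ →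
                 ∀ k → cofactor (λ i → Q i ⊖ o) k ≉ 0#
    cofactor≉0 Q Q∈S Q≉o a Σa≈1 aQ≋0 k = x*y≉0 (sign≉0 (toℕ k))
      (independent⇒det≉0 (λ i → removeAt Q k i ⊖ o)
        (independent d ℕ.≤-refl (removeAt Q k) (Q∈S ∘ punchIn k) (Q≉o ∘ punchIn k)
          λ i j i≢j → distinct (λ eq → i≢j (punchIn-injective k i j eq))))
      where
      distinct : ∀ {i j} → i ≢ j → ¬ Q i ≋ Q j
      distinct {i} i≢j Qᵢ≋Qⱼ =
        let b , Σb≈Σa , bQ≋aQ = merge (λ i → Q i ⊖ o) i≢j (λ l → +-congʳ (Qᵢ≋Qⱼ l)) a in
        ∉-affine-hull d ℕ.≤-refl (removeAt Q i) (Q∈S ∘ punchIn i) (Q≉o ∘ punchIn i)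
          b (trans Σb≈Σa Σa≈1) (≋-trans bQ≋aQ aQ≋0)
      sign≉0 : ∀ n → (- 1#) ^ n ≉ 0#
      sign≉0 n ςⁿ≈0 = 1≉0 (trans (sym (sign²≈1 n)) (trans (*-congʳ ςⁿ≈0) (zeroˡ _)))

  -- Central projection

  dot-linear : ∀ {m} (w : Point m) → IsLinear ⟨_, w ⟩
  dot-linear w = record
    { cong        = λ x≋y → sum-cong-≋ λ j → *-congʳ (x≋y j)
    ; additive    = λ x y → trans (sum-cong-≋ λ j → distribʳ (w j) (x j) (y j))
        (∑-distrib-+ (λ j → x j * w j) (λ j → y j * w j))
    ; homogeneous = λ a x → trans (sum-cong-≋ λ j → *-assoc a (x j) (w j))
        (sym (*-distribˡ-sum a (λ j → x j * w j)))
    }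

  dot-comm : ∀ {m} (x y : Point m) → ⟨ x , y ⟩ ≈ ⟨ y , x ⟩
  dot-comm x y = sum-cong-≋ λ j → *-comm (x j) (y j)

  basis-diagonal : ∀ {m} (i : Fin m) → basis i i ≡ 1#
  basis-diagonal zero    = ≡.refl
  basis-diagonal (suc i) = basis-diagonal i

  basis-off-diagonal : ∀ {m} (i j : Fin m) → i ≢ j → basis i j ≡ 0#
  basis-off-diagonal zero    zero    0≢0 = contradiction ≡.refl 0≢0
  basis-off-diagonal zero    (suc j) _   = ≡.refl
  basis-off-diagonal (suc i) zero    _   = ≡.refl
  basis-off-diagonal (suc i) (suc j) i≢j = basis-off-diagonal i j λ { ≡.refl → i≢j ≡.refl }

  module Projection {n} {o : Point (suc n)} {Π : OrientedHyperplaneThrough o}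
                    (Π′ : ParallelHyperplane Π) where
    open OrientedHyperplaneThrough Π
    open ParallelHyperplane Π′

    -- The factor `h` reflects the height of the image hyperplane: dividing `coordinates (q ⊖ o)` by
    -- its first entry produces the row formed by 1 and the projection of `q`.
    coordinates : Point (suc n) → Point (suc n)
    coordinates u = ⟨ u , ν ⟩ ∷ λ l → h * ⟨ u , e l ⟩

    coordinates-linear : IsLinearMap coordinates
    coordinates-linear zero    = dot-linear ν
    coordinates-linear (suc l) = *-linear h (dot-linear (e l))

    h≉0 : h ≉ 0#
    h≉0 h≈0 = <-irrefl (sym h≈0) h-positive

    ν⊥e : ∀ l → ⟨ ν , e l ⟩ ≈ 0#
    ν⊥e l = trans (dot-comm ν (e l)) (e-parallel l)

    -- The basis dual to `coordinates`, with `inv h h≉0` compensating for the factor `h`. It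
    -- witnesses that the determinant `δ` of the coordinate map cannot vanish.
    frame : Vector (Point (suc n)) (suc n)
    frame = ν ∷ λ l → inv h h≉0 ⊙ e l

    e-orthonormal : ∀ i l → ⟨ e i , e l ⟩ ≈ basis i l
    e-orthonormal i l with i ≟ l
    ... | yes ≡.refl = trans (e-unit i) (reflexive (≡.sym (basis-diagonal i)))
    ... | no  i≢l    = trans (e-orth i l i≢l) (reflexive (≡.sym (basis-off-diagonal i l i≢l)))

    coordinates-frame : coordinates ∘ frame ≋* basis
    coordinates-frame zero    zero    = unit
    coordinates-frame zero    (suc l) = trans (*-congˡ (ν⊥e l)) (zeroʳ h)
    coordinates-frame (suc i) zero    = trans (homogeneous (dot-linear ν) _ (e i))
      (trans (*-congˡ (e-parallel i)) (zeroʳ _))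
    coordinates-frame (suc i) (suc l) = begin
      h * ⟨ inv h h≉0 ⊙ e i , e l ⟩     ≈⟨ *-congˡ (homogeneous (dot-linear (e l)) _ (e i)) ⟩
      h * (inv h h≉0 * ⟨ e i , e l ⟩)   ≈⟨ *-assoc _ _ _ ⟨
      h * inv h h≉0 * ⟨ e i , e l ⟩     ≈⟨ *-congʳ (inverseʳ h h≉0) ⟩
      1# * ⟨ e i , e l ⟩                ≈⟨ *-identityˡ _ ⟩
      ⟨ e i , e l ⟩                     ≈⟨ e-orthonormal i l ⟩
      basis i l                         ∎

    δ : Carrier
    δ = det (coordinates ∘ basis)

    δ≉0 : δ ≉ 0#
    δ≉0 δ≈0 = 1≉0 (begin
      1#                        ≈⟨ det-basis {suc n} ⟨
      det (basis {suc n})       ≈⟨ det-cong {suc n} coordinates-frame ⟨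
      det (coordinates ∘ frame) ≈⟨ det-map coordinates-linear frame ⟩
      δ * det frame             ≈⟨ trans (*-congʳ δ≈0) (zeroˡ _) ⟩
      0#                        ∎)

    homogenise : ∀ q (q∉Π : ¬ OnHyperplane q) →
      1# ∷ π q q∉Π ≋ inv (height q) q∉Π ⊙ coordinates (q ⊖ o)
    homogenise q q∉Π zero    = sym (trans (*-comm _ _) (inverseʳ _ q∉Π))
    homogenise q q∉Π (suc l) = begin
      ⟨ (o ⊕ t ⊙ u) ⊖ (o ⊕ h ⊙ ν) , e l ⟩
        ≈⟨ cong (dot-linear (e l)) (λ j → trans (difference (o j) (t * u j) (h * ν j))
             (+-congˡ (-‿distribˡ-* h (ν j)))) ⟩
      ⟨ t ⊙ u ⊕ (- h) ⊙ ν , e l ⟩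
        ≈⟨ additive (dot-linear (e l)) (t ⊙ u) ((- h) ⊙ ν) ⟩
      ⟨ t ⊙ u , e l ⟩ + ⟨ (- h) ⊙ ν , e l ⟩
        ≈⟨ +-cong (homogeneous (dot-linear (e l)) t u) (homogeneous (dot-linear (e l)) (- h) ν) ⟩
      t * ⟨ u , e l ⟩ + (- h) * ⟨ ν , e l ⟩
        ≈⟨ +-congˡ (trans (*-congˡ (ν⊥e l)) (zeroʳ _)) ⟩
      t * ⟨ u , e l ⟩ + 0#
        ≈⟨ +-identityʳ _ ⟩
      h * inv (height q) q∉Π * ⟨ u , e l ⟩
        ≈⟨ trans (*-congʳ (*-comm _ _)) (*-assoc _ _ _) ⟩
      inv (height q) q∉Π * (h * ⟨ u , e l ⟩) ∎
      where
      t = h * inv (height q) q∉Π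
      u = q ⊖ o
      difference : ∀ x y z → (x + y) - (x + z) ≈ y - z
      difference x y z = begin
        (x + y) - (x + z)     ≈⟨ +-congˡ (-‿+-comm x z) ⟨
        x + y + (- x - z)     ≈⟨ +-interchange x y (- x) (- z) ⟩
        x - x + (y - z)       ≈⟨ +-congʳ (-‿inverseʳ x) ⟩
        0# + (y - z)          ≈⟨ +-identityˡ _ ⟩
        y - z                 ∎

    det-projection : ∀ (q : Vector (Point (suc n)) (suc n)) (q∉Π : ∀ i → ¬ OnHyperplane (q i)) →
      det (λ i → 1# ∷ π (q i) (q∉Π i)) ≈
      product (λ i → inv (height (q i)) (q∉Π i)) * (δ * det (λ i → q i ⊖ o))
    det-projection q q∉Π = begin
      det (λ i → 1# ∷ π (q i) (q∉Π i))
        ≈⟨ det-cong {suc n} (λ i → homogenise (q i) (q∉Π i)) ⟩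
      det (λ i → s i ⊙ coordinates (q i ⊖ o))
        ≈⟨ scale-rows (det-alternating {suc n}) s (λ i → coordinates (q i ⊖ o)) ⟩
      product s * det (λ i → coordinates (q i ⊖ o))
        ≈⟨ *-congˡ (det-map coordinates-linear (λ i → q i ⊖ o)) ⟩
      product s * (δ * det (λ i → q i ⊖ o)) ∎
      where
      s : Vector Carrier (suc n)
      s i = inv (height (q i)) (q∉Π i)

    -- In `det-projection` the factor `δ` is common to both sequences, and the products of inverse
    -- heights agree in sign. Being nonzero, both factors cancel.
    sgn-det-from-projection : ∀ (q q′ : Vector (Point (suc n)) (suc n))
      (q∉Π : ∀ i → ¬ OnHyperplane (q i)) (q′∉Π : ∀ i → ¬ OnHyperplane (q′ i)) →
      χ (λ i → π (q i) (q∉Π i)) ≡ χ (λ i → π (q′ i) (q′∉Π i)) →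
      (∀ i → sgnπ (q i) (q∉Π i) ≡ sgnπ (q′ i) (q′∉Π i)) →
      sgn (det λ i → q i ⊖ o) ≡ sgn (det λ i → q′ i ⊖ o)
    sgn-det-from-projection q q′ q∉Π q′∉Π χ≡ sgn≡ =
      sgn-*-cancelˡ δ≉0 ≡.refl
        (sgn-*-cancelˡ (product≉0 {suc n} λ i → inv≉0 (q∉Π i))
          (sgn-product {suc n} λ i → ≡.trans (sgn-inv (q∉Π i))
            (≡.trans (sgn≡ i) (≡.sym (sgn-inv (q′∉Π i)))))
          (≡.trans (≡.sym (sgn-cong (det-projection q q∉Π)))
            (≡.trans χ≡ (sgn-cong (det-projection q′ q′∉Π)))))

-- Strictly increasing selections of indices

StrictlyMonotone : ∀ {m n} → (Fin m → Fin n) → Set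
StrictlyMonotone i = ∀ {a b} → a Fin.< b → i a Fin.< i b

-- The selections omitting one index `k` are those at which the order type of the projected
-- sequences is used, one for each minor.
punchIn-strictlyMonotone : ∀ {n} (k : Fin (suc n)) → StrictlyMonotone (punchIn k)
punchIn-strictlyMonotone k a<b =
  ℕ.≰⇒> λ b≤a → ℕ.<⇒≱ a<b (punchIn-cancel-≤ k _ _ b≤a)

-- Reduces the order type of `d + 1` points in dimension `d` to a single orientation. No successor
-- is sent to zero, so the map restricts to a smaller one, which is the identity by induction; a
-- value `suc k` at zero would then collide with the value at `suc k`.
strictlyMonotone⇒id : ∀ {m} (i : Fin m → Fin m) → StrictlyMonotone i → ∀ k → i k ≡ k
strictlyMonotone⇒id {suc m} i mono = i≡id
  where
  0≢i : ∀ k → zero ≢ i (suc k)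
  0≢i k 0≡i = ℕ.n≮0 (≡.subst (i zero Fin.<_) (≡.sym 0≡i) (mono (s≤s z≤n)))
  i′ : Fin m → Fin m
  i′ k = punchOut (0≢i k)
  suc-i′ : ∀ k → suc (i′ k) ≡ i (suc k)
  suc-i′ k = punchIn-punchOut (0≢i k)
  i′-mono : StrictlyMonotone i′
  i′-mono {a} {b} a<b = ℕ.s<s⁻¹
    (≡.subst₂ Fin._<_ (≡.sym (suc-i′ a)) (≡.sym (suc-i′ b)) (mono (s≤s a<b)))
  i-suc : ∀ k → i (suc k) ≡ suc k
  i-suc k = ≡.trans (≡.sym (suc-i′ k)) (≡.cong suc (strictlyMonotone⇒id i′ i′-mono k))
  i≡id : ∀ k → i k ≡ k
  i≡id (suc k) = i-suc k
  i≡id zero with i zero in i₀≡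
  ... | zero  = ≡.refl
  ... | suc k = contradiction
    (≡.subst₂ Fin._<_ i₀≡ (i-suc k) (mono (s≤s z≤n))) (ℕ.<-irrefl ≡.refl)

-- Transfer of cofactor signs from `Q` to `Q′`

theorem7 : ∀ {c ℓ₁ ℓ₂} (R : Reals c ℓ₁ ℓ₂) →
    let open Geometry (Reals.orderedField R)
        open OrientedHyperplaneThrough
        open ParallelHyperplane in
    (n : ℕ) →
    let d = suc n in
    (Q Q′ : Vector (Point d) (suc d)) (o : Point d)
    (Π : OrientedHyperplaneThrough o) (Π′ : ParallelHyperplane Π) →
    GeneralPosition (range Q ∪ range Q′ ∪ (o ≋_)) →
    (Q∉Π : ∀ i → ¬ OnHyperplane Π (Q i)) →
    (Q′∉Π : ∀ i → ¬ OnHyperplane Π (Q′ i)) →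
    o ∈ conv Q →
    (λ i → π Π′ (Q i) (Q∉Π i)) ≃ (λ i → π Π′ (Q′ i) (Q′∉Π i)) →
    (∀ i → sgnπ Π′ (Q i) (Q∉Π i) ≡ sgnπ Π′ (Q′ i) (Q′∉Π i)) →
    o ∈ conv Q′ × Q ≃ Q′
theorem7 R n Q Q′ o Π Π′ gp Q∉Π Q′∉Π (a , 0≤a , Σa≈1 , o≋aQ) π≃π′ sgn≡ =
  (a′ , 0≤a′ , Σa′≈1 , o≋a′Q′) , Q≃Q′
  where
  F = Reals.orderedField R
  open OrderedField F hiding (zero)
  open Geometry F
  open import Algebra.Properties.Ring ring
  open import Algebra.Properties.Semiring.Sum semiring
  open import Relation.Binary.Reasoning.Setoid setoid
  open LinearAlgebra F
  open IsLinear
  open OrientedHyperplaneThrough Π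
  open Projection Π′

  u u′ : Vector (Point (suc n)) (suc (suc n))
  u  i = Q i ⊖ o
  u′ i = Q′ i ⊖ o

  au≋0 : lincomb a u ≋ 0ᵥ
  au≋0 j = trans (lincomb-⊖ a Q o Σa≈1 j)
    (trans (+-congʳ (sym (o≋aQ j))) (-‿inverseʳ (o j)))

  Q≉o : ∀ i → ¬ Q i ≋ o
  Q≉o i Qᵢ≋o = Q∉Π i (trans
    (cong (dot-linear ν) λ j → trans (+-congʳ (Qᵢ≋o j)) (-‿inverseʳ (o j)))
    (preserves-0 (dot-linear ν)))

  S S′ : Carrier
  S  = det λ i → 1# ∷ u i
  S′ = det λ i → 1# ∷ u′ i

  cofactor-u≉0 : ∀ k → cofactor u k ≉ 0#
  cofactor-u≉0 = cofactor≉0 {S = range Q ∪ range Q′ ∪ (o ≋_)} gp (inj₂ (inj₂ ≋-refl)) Q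
    (λ i → inj₁ (i , ≋-refl)) Q≉o a Σa≈1 au≋0

  S≉0 : S ≉ 0#
  S≉0 S≈0 = cofactor-u≉0 zero (trans (cramer u a Σa≈1 au≋0 zero)
    (trans (*-congˡ S≈0) (zeroʳ _)))

  sgn-cofactor : ∀ k → sgn (cofactor u k) ≡ sgn (cofactor u′ k)
  sgn-cofactor k = sgn-*-cong ≡.refl (sgn-det-from-projection
    (removeAt Q k) (removeAt Q′ k) (Q∉Π ∘ punchIn k) (Q′∉Π ∘ punchIn k)
    (π≃π′ (punchIn k) (punchIn-strictlyMonotone k)) (sgn≡ ∘ punchIn k))

  -- Weighting by `S` avoids a case distinction on its sign: by Cramer's rule `S * cofactor u k`
  -- equals `a k * (S * S)`, which is nonnegative.
  sgn-S*cofactor : ∀ k → sgn (S * cofactor u k) ≡ sgn (S * cofactor u′ k)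
  sgn-S*cofactor k = sgn-*-cong ≡.refl (sgn-cofactor k)

  0≤S*cofactor : ∀ k → 0# ≤ S * cofactor u k
  0≤S*cofactor k = 0≤-resp-sgn
    (sgn-cong (trans (sym (*-assoc _ _ _))
      (trans (*-comm _ _) (*-congˡ (sym (cramer u a Σa≈1 au≋0 k))))))
    (*-nonNeg-pos (0≤a k) (x≉0⇒0<x*x S≉0))

  0≤S*cofactor′ : ∀ k → 0# ≤ S * cofactor u′ k
  0≤S*cofactor′ k = 0≤-resp-sgn (sgn-S*cofactor k) (0≤S*cofactor k)

  -- One strictly positive summand suffices for `S * S′` to be positive; index zero is chosen
  -- because it is the head of the sum.
  0<S*cofactor′₀ : 0# < S * cofactor u′ zero
  0<S*cofactor′₀ = sgn≡1⇒pos (≡.trans (≡.sym (sgn-S*cofactor zero))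
    (sgn-pos (0≤x∧x≉0⇒0<x (0≤S*cofactor zero) (x*y≉0 S≉0 (cofactor-u≉0 zero)))))

  SS′≈Σ : S * S′ ≈ sum λ k → S * cofactor u′ k
  SS′≈Σ = trans (*-congˡ (sym (sum-cofactor u′))) (*-distribˡ-sum S (cofactor u′))

  0<SS′ : 0# < S * S′
  0<SS′ = <-respʳ (sym SS′≈Σ) (+-pos-nonNeg 0<S*cofactor′₀ (sum-nonNeg (0≤S*cofactor′ ∘ suc)))

  SS′≉0 : S * S′ ≉ 0#
  SS′≉0 SS′≈0 = <-irrefl (sym SS′≈0) 0<SS′

  w : Carrier
  w = inv (S * S′) SS′≉0

  -- In effect this is `cofactor u′ k` divided by `S′`; the common factor `S` makes the numerator
  -- nonnegative and the denominator positive.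
  a′ : Vector Carrier (suc (suc n))
  a′ k = S * cofactor u′ k * w

  0≤a′ : ∀ k → 0# ≤ a′ k
  0≤a′ k = *-nonNeg-pos (0≤S*cofactor′ k)
    (sgn≡1⇒pos (≡.trans (sgn-inv SS′≉0) (sgn-pos 0<SS′)))

  Σa′≈1 : sum a′ ≈ 1#
  Σa′≈1 = begin
    sum a′                       ≈⟨ *-distribʳ-sum w (λ k → S * cofactor u′ k) ⟨
    sum (λ k → S * cofactor u′ k) * w   ≈⟨ *-congʳ SS′≈Σ ⟨
    S * S′ * w                   ≈⟨ inverseʳ (S * S′) SS′≉0 ⟩
    1#                           ∎

  a′u′≋0 : lincomb a′ u′ ≋ 0ᵥ
  a′u′≋0 j = begin
    sum (λ k → S * cofactor u′ k * w * u′ k j)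
      ≈⟨ sum-cong-≋ {suc (suc n)} (λ k → trans (*-congʳ {u′ k j}
           (trans (*-comm (S * cofactor u′ k) w) (sym (*-assoc w S (cofactor u′ k)))))
           (*-assoc (w * S) (cofactor u′ k) (u′ k j))) ⟩
    sum (λ k → w * S * (cofactor u′ k * u′ k j))
      ≈⟨ *-distribˡ-sum (w * S) (λ k → cofactor u′ k * u′ k j) ⟨
    w * S * lincomb (cofactor u′) u′ j
      ≈⟨ *-congˡ (cofactor-relation u′ j) ⟩
    w * S * 0#
      ≈⟨ zeroʳ _ ⟩
    0# ∎

  o≋a′Q′ : o ≋ lincomb a′ Q′
  o≋a′Q′ j = sym (x∙y⁻¹≈ε⇒x≈y _ _
    (trans (sym (lincomb-⊖ a′ Q′ o Σa′≈1 j)) (a′u′≋0 j)))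

  -- Both `S * S` and `S * S′` are positive, so the nonzero factor `S` cancels.
  sgn-S : sgn S ≡ sgn S′
  sgn-S = sgn-*-cancelˡ S≉0 ≡.refl
    (≡.trans (sgn-pos (x≉0⇒0<x*x S≉0)) (≡.sym (sgn-pos 0<SS′)))

  Q≃Q′ : Q ≃ Q′
  Q≃Q′ i mono = ≡.trans (χ≡sgn-S Q) (≡.trans sgn-S (≡.sym (χ≡sgn-S Q′)))
    where
    χ≡sgn-S : (P : Vector (Point (suc n)) (suc (suc n))) →
              χ (P ∘ i) ≡ sgn (det λ k → 1# ∷ P k ⊖ o)
    χ≡sgn-S P = sgn-cong (trans
      (det-cong {suc (suc n)} {λ k → 1# ∷ P (i k)} {λ k → 1# ∷ P k}
        λ k j → reflexive (≡.cong (λ l → (1# ∷ P l) j) (strictlyMonotone⇒id i mono k)))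
      (sym (det-translate o P)))
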